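{- For every integer $n \geq 1$, the polynomial $P_n(x) = \sum_{\pi \in \mathrm{PF}_n} x^{\mathrm{sum}(\pi)}$ is log-concave, where $\mathrm{PF}_n$ is the set of parking functions of length $n$ and $\mathrm{sum}(a_1,\ldots,a_n) = a_1 + \cdots + a_n$.
   Context: A parking function of length $n$ is a sequence $(a_1,\ldots,a_n)$ of positive integers whose nondecreasing rearrangement $b_1 \leq \cdots \leq b_n$ satisfies $b_i \leq i$ for all $1 \leq i \leq n$. A polynomial is called log-concave if its sequence of coefficients $a_0, a_1, \ldots, a_d$ satisfies $a_i^2 \geq a_{i-1}a_{i+1}$ for all $0 < i < d$. -}

module Defs where

open import Data.Nat using (ℕ; zero; suc; _+_; _*_; _≤_; _<_; _≤?_; _/_)
open import Data.Nat.Properties using (≤-decTotalOrder)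
open import Data.List using (List; []; _∷_; map; concatMap; length; filter; upTo)
open import Data.Nat.ListAction using (sum)
open import Data.List.Relation.Unary.All using (All)
open import Data.List.Relation.Unary.All using (all?)
open import Data.Vec using (Vec; toList)
import Data.Vec as V
open import Data.Fin using (Fin; toℕ)
open import Data.Product using (_×_; _,_)
open import Relation.Binary.PropositionalEquality using (_≡_)
open import Relation.Nullary using (Dec; yes; no)
open import Relation.Nullary.Decidable using (_×-dec_)
import Data.Nat as N
open import Data.List.Sort.InsertionSort ≤-decTotalOrder using (sort)

rearr : ∀ {n} → Vec ℕ n → List ℕ
rearr v = sort (toList v)

BoundedFrom : ℕ → List ℕ → Set
BoundedFrom i []       = Data.Unit.⊤ where import Data.Unit
BoundedFrom i (b ∷ bs) = (b ≤ i) × BoundedFrom (suc i) bs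

boundedFrom? : ∀ i bs → Dec (BoundedFrom i bs)
boundedFrom? i []       = yes _
boundedFrom? i (b ∷ bs) = (b ≤? i) ×-dec boundedFrom? (suc i) bs

IsParkingFunction : ∀ {n} → Vec ℕ n → Set
IsParkingFunction v = All (λ a → 1 ≤ a) (toList v) × BoundedFrom 1 (rearr v)

isParkingFunction? : ∀ {n} (v : Vec ℕ n) → Dec (IsParkingFunction v)
isParkingFunction? v = all? (λ a → 1 ≤? a) (toList v) ×-dec boundedFrom? 1 (rearr v)

vsum : ∀ {n} → Vec ℕ n → ℕ
vsum v = sum (toList v)

boxVecs : (n m : ℕ) → List (Vec ℕ n)
boxVecs zero    m = V.[] ∷ []
boxVecs (suc n) m = concatMap (λ a → map (a V.∷_) (boxVecs n m)) (map suc (upTo m))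

-- Coefficient of x^k in P_n(x) = Σ_{π ∈ PF_n} x^{sum π}:
-- the number of parking functions of length n with sum k.
-- Any sequence of positive integers with sum k has all entries in {1..k},
-- so enumerating {1..k}^n is exhaustive for this count.
coeff : (n k : ℕ) → ℕ
coeff n k = length (filter (λ v → isParkingFunction? v ×-dec (vsum v N.≟ k)) (boxVecs n k))

-- Degree of P_n: the maximal sum of a parking function, n(n+1)/2.
degree : ℕ → ℕ
degree n = (n * suc n) / 2

LogConcave : (c : ℕ → ℕ) (d : ℕ) → Set
LogConcave c d = ∀ i → 0 < i → i < d → c (N.pred i) * c (suc i) ≤ c i * c i

{-# OPTIONS --safe #-}

-- A parking function of length n puts n labels on n levels in such a way that, for every j,
-- at least j labels lie on the lowest j levels.  More generally let K rs s d be the generating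
-- polynomial, by total level, of the placements of d labels that respect arbitrary guards of this kind
-- (with s further labels below all levels).  Write A ≼ B when the ratio of the coefficients of B and A is
-- nondecreasing, so that f is log-concave iff f ≼ q f.  Raising one distinguished label by one level
-- telescopes and gives f + N = q f + A for f = K rs s (d + 1), where A consists of the
-- placements with that label on the bottom level and N of those in which it stops just short of a guard.
-- This identity reduces log-concavity of f to A ≼ f ≼ N.  Both relations compare products of polynomials
-- of the same kind with at most d labels, so they follow by induction on d from the facts that ≼ survives
-- products with log-concave factors and mixtures with monotone weights (Cauchy–Binet).
module Submission where

open import Defs
open import Data.Nat using (ℕ; _≤_)
open import Data.Nat using (zero; suc; pred; _+_; _*_; _∸_; _<_; _!; z≤n; s≤s; _≤?_; _≟_)
open import Data.Nat.Properties
open import Data.Nat.Tactic.RingSolver using (solve-∀)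
open import Data.List using (List; []; _∷_; _++_; [_]; length; map; filter; concatMap; applyUpTo)
open import Data.List.Properties
  using (++-assoc; length-++; length-map; length-filter; filter-all; filter-none; filter-accept; filter-reject;
      filter-++; filter-complete)
open import Data.List.Relation.Unary.All using (All; []; _∷_; all?; universal)
open import Data.List.Relation.Unary.All.Properties using (all-filter)
open import Data.List.Relation.Unary.AllPairs using (AllPairs; []; _∷_)
open import Data.List.Relation.Unary.Linked.Properties using (Linked⇒AllPairs)
open import Data.List.Relation.Binary.Permutation.Propositional.Properties using (filter-↭; ↭-length)
open import Data.List.Reverse using (Reverse; reverseView; _∶_∶ʳ_) renaming ([] to []ʳ)
open import Data.List.Sort.InsertionSort ≤-decTotalOrder using (sort)
open import Data.List.Sort.InsertionSort.Properties ≤-decTotalOrder using (sort-↭; sort-↗)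
open import Data.Vec using (Vec; toList) renaming ([] to []ᵛ; _∷_ to _∷ᵛ_)
open import Data.Vec.Properties using (length-toList)
open import Data.Product using (_×_; _,_; ∃; proj₁; proj₂)
open import Data.Sum using (_⊎_; inj₁; inj₂)
open import Data.Unit using (⊤; tt)
open import Data.Empty using (⊥)
open import Function using (_∘_; id; flip)
open import Relation.Nullary using (¬_; yes; no; contradiction)
open import Relation.Nullary.Decidable using (_×-dec_)
open import Relation.Unary using (Decidable)
open import Relation.Binary.PropositionalEquality hiding ([_])

-- Log-concavity is not inherited by sums, and `K` is a sum over the number of labels that stay low.
-- What can be carried through such a sum is a comparison `≼` of two weighted families. Singling out
-- one of `suc d` labels replaces the weights `bin` by `binˡ` or `binʳ`, and the ratio of either to
-- `bin` is monotone in the number of low labels; this drives every mixture below. Fixing how many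
-- labels lie below a level leaves two independent problems of the same kind, the upper one with
-- labels already beneath it. This is why `s` and arbitrary guards are needed even though parking
-- functions start from `s = 0` and guards `1, …, m`. A label held at the bottom gives the smallest
-- ratio and a label held at the top the largest. For a single guard, the terms with the label held
-- just above that guard interlace with the terms of `f`, which yields `f ≼ N`. The obstacle is that
-- `≼` is transitive only through a nonzero middle term, while guards can make terms vanish. Hence
-- each chain of comparisons is preceded by a case distinction on feasibility.

-- Sums over the antidiagonal `i + j = d`, and the Cauchy-Binet inequality.

∑ : ℕ → (ℕ → ℕ → ℕ) → ℕ
∑ zero    f = f 0 0
∑ (suc d) f = f 0 (suc d) + ∑ d (λ i j → f (suc i) j)

∑-cong : ∀ d {f g : ℕ → ℕ → ℕ} → (∀ i j → i + j ≡ d → f i j ≡ g i j) → ∑ d f ≡ ∑ d g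
∑-cong zero    h = h 0 0 refl
∑-cong (suc d) h = cong₂ _+_ (h 0 (suc d) refl) (∑-cong d λ i j e → h (suc i) j (cong suc e))

∑-mono : ∀ d {f g : ℕ → ℕ → ℕ} → (∀ i j → i + j ≡ d → f i j ≤ g i j) → ∑ d f ≤ ∑ d g
∑-mono zero    h = h 0 0 refl
∑-mono (suc d) h = +-mono-≤ (h 0 (suc d) refl) (∑-mono d λ i j e → h (suc i) j (cong suc e))

∑-zero : ∀ d → ∑ d (λ _ _ → 0) ≡ 0
∑-zero zero    = refl
∑-zero (suc d) = ∑-zero d

∑-+ : ∀ d f g → ∑ d (λ i j → f i j + g i j) ≡ ∑ d f + ∑ d g
∑-+ zero    f g = refl
∑-+ (suc d) f g = trans (cong (f 0 (suc d) + g 0 (suc d) +_) (∑-+ d _ _)) (interchange (f 0 (suc d)) _ _ _)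
  where
  interchange : ∀ a b c e → a + b + (c + e) ≡ a + c + (b + e)
  interchange = solve-∀

∑-*ˡ : ∀ d c f → ∑ d (λ i j → c * f i j) ≡ c * ∑ d f
∑-*ˡ zero    c f = refl
∑-*ˡ (suc d) c f = trans (cong (c * f 0 (suc d) +_) (∑-*ˡ d c _)) (sym (*-distribˡ-+ c _ _))

∑-*ʳ : ∀ d c f → ∑ d (λ i j → f i j * c) ≡ ∑ d f * c
∑-*ʳ d c f = trans (∑-cong d λ i j _ → *-comm (f i j) c) (trans (∑-*ˡ d c f) (*-comm c _))

∑-last : ∀ d f → ∑ (suc d) f ≡ ∑ d (λ i j → f i (suc j)) + f (suc d) 0
∑-last zero    f = refl
∑-last (suc d) f = trans (cong (f 0 (suc (suc d)) +_) (∑-last d (λ i j → f (suc i) j)))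
    (sym (+-assoc (f 0 (suc (suc d))) _ _))

∑-flip : ∀ d f → ∑ d f ≡ ∑ d (flip f)
∑-flip zero    f = refl
∑-flip (suc d) f = trans (cong (f 0 (suc d) +_) (∑-flip d _)) (trans (+-comm (f 0 (suc d)) _) (sym (∑-last d (flip f))))

∑-assoc : ∀ d (f : ℕ → ℕ → ℕ → ℕ) →
          ∑ d (λ i j → ∑ j (λ k l → f i k l)) ≡ ∑ d (λ m l → ∑ m (λ i k → f i k l))
∑-assoc zero    f = refl
∑-assoc (suc d) f = begin
  f 0 0 (suc d) + X + ∑ d (λ i j → ∑ j (f (suc i)))                     ≡⟨ cong (f 0 0 (suc d) + X +_)
      (∑-assoc d (λ i → f (suc i))) ⟩
  f 0 0 (suc d) + X + ∑ d (λ m l → ∑ m (λ i k → f (suc i) k l))         ≡⟨ +-assoc (f 0 0 (suc d)) X _ ⟩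
  f 0 0 (suc d) + (X + ∑ d (λ m l → ∑ m (λ i k → f (suc i) k l)))       ≡⟨ cong (f 0 0 (suc d) +_) (∑-+ d _ _) ⟨
  f 0 0 (suc d) + ∑ d (λ m l → f 0 (suc m) l + ∑ m (λ i k → f (suc i) k l)) ∎
  where
  open ≡-Reasoning
  X = ∑ d (λ k l → f 0 (suc k) l)

∑-swap : ∀ d e (f : ℕ → ℕ → ℕ → ℕ → ℕ) →
         ∑ d (λ i j → ∑ e (λ k l → f i j k l)) ≡ ∑ e (λ k l → ∑ d (λ i j → f i j k l))
∑-swap zero    e f = refl
∑-swap (suc d) e f = trans (cong (∑ e (f 0 (suc d)) +_) (∑-swap d e _)) (sym (∑-+ e _ _))

-- The difference of the two sides is `(α - β) * (γ - η)`.
rearrange : ∀ {α β γ η} → β ≤ α → η ≤ γ → α * η + β * γ ≤ α * γ + β * η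
rearrange {α} {β} {γ} {η} β≤α η≤γ with m≤n⇒∃[o]m+o≡n β≤α | m≤n⇒∃[o]m+o≡n η≤γ
... | x , refl | y , refl = subst ((β + x) * η + β * (η + y) ≤_) (lem β x η y) (m≤m+n _ (x * y))
  where
  lem : ∀ β x η y → (β + x) * η + β * (η + y) + x * y ≡ (β + x) * (η + y) + β * η
  lem = solve-∀

-- Cauchy–Binet for two rows and two columns: both factors of every 2 × 2 minor have the same sign.
∑-CauchyBinet : ∀ d (p q u v : ℕ → ℕ → ℕ) →
  (∀ {i j i′ j′} → i + j ≡ d → i′ + j′ ≡ d → i < i′ → p i′ j′ * q i j ≤ p i j * q i′ j′) →
  (∀ {i j i′ j′} → i + j ≡ d → i′ + j′ ≡ d → i < i′ → u i′ j′ * v i j ≤ u i j * v i′ j′) →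
  ∑ d (λ i j → p i j * v i j) * ∑ d (λ i j → q i j * u i j) ≤
  ∑ d (λ i j → p i j * u i j) * ∑ d (λ i j → q i j * v i j)
∑-CauchyBinet zero    p q u v pq uv = ≤-reflexive (lem (p 0 0) (q 0 0) (u 0 0) (v 0 0))
  where
  lem : ∀ p q u v → p * v * (q * u) ≡ p * u * (q * v)
  lem = solve-∀
∑-CauchyBinet (suc d) p q u v pq uv = begin
  (p₀ * v₀ + PV) * (q₀ * u₀ + QU)                                ≡⟨ expand (p₀ * v₀) PV (q₀ * u₀) QU ⟩
  p₀ * v₀ * (q₀ * u₀) + PV * QU + (p₀ * v₀ * QU + PV * (q₀ * u₀)) ≤⟨ +-mono-≤
      (+-mono-≤ (≤-reflexive (lem p₀ q₀ u₀ v₀)) ih) cross ⟩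
  p₀ * u₀ * (q₀ * v₀) + PU * QV + (p₀ * u₀ * QV + PU * (q₀ * v₀)) ≡⟨ expand (p₀ * u₀) PU (q₀ * v₀) QV ⟨
  (p₀ * u₀ + PU) * (q₀ * v₀ + QV)                                ∎
  where
  open ≤-Reasoning
  p₀ = p 0 (suc d)
  q₀ = q 0 (suc d)
  u₀ = u 0 (suc d)
  v₀ = v 0 (suc d)
  PV = ∑ d (λ i j → p (suc i) j * v (suc i) j)
  QU = ∑ d (λ i j → q (suc i) j * u (suc i) j)
  PU = ∑ d (λ i j → p (suc i) j * u (suc i) j)
  QV = ∑ d (λ i j → q (suc i) j * v (suc i) j)
  expand : ∀ a b c e → (a + b) * (c + e) ≡ a * c + b * e + (a * e + b * c)
  expand = solve-∀
  lem : ∀ p q u v → p * v * (q * u) ≡ p * u * (q * v)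
  lem = solve-∀
  ih : PV * QU ≤ PU * QV
  ih = ∑-CauchyBinet d (λ i → p (suc i)) (λ i → q (suc i)) (λ i → u (suc i)) (λ i → v (suc i))
         (λ e e′ l → pq (cong suc e) (cong suc e′) (s≤s l)) (λ e e′ l → uv (cong suc e) (cong suc e′) (s≤s l))
  merge : ∀ (a b : ℕ) f g → a * ∑ d f + ∑ d g * b ≡ ∑ d (λ i j → a * f i j + g i j * b)
  merge a b f g = sym (trans (∑-+ d _ _) (cong₂ _+_ (∑-*ˡ d a f) (∑-*ʳ d b g)))
  -- The mixed products pair column `0` with each column `suc i`. For each pair the difference is a
  -- product of two minors of equal sign, so `rearrange` applies termwise.
  cross : p₀ * v₀ * QU + PV * (q₀ * u₀) ≤ p₀ * u₀ * QV + PU * (q₀ * v₀)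
  cross = begin
    p₀ * v₀ * QU + PV * (q₀ * u₀) ≡⟨ merge (p₀ * v₀) (q₀ * u₀) _ _ ⟩
    ∑ d (λ i j → p₀ * v₀ * (q (suc i) j * u (suc i) j) + p (suc i) j * v (suc i) j * (q₀ * u₀))
      ≤⟨ ∑-mono d (λ i j e → begin
           p₀ * v₀ * (q (suc i) j * u (suc i) j) + p (suc i) j * v (suc i) j * (q₀ * u₀)
             ≡⟨ re p₀ v₀ (q (suc i) j) (u (suc i) j) (p (suc i) j) (v (suc i) j) q₀ u₀ ⟩
           p₀ * q (suc i) j * (u (suc i) j * v₀) + p (suc i) j * q₀ * (u₀ * v (suc i) j)
             ≤⟨ rearrange (pq refl (cong suc e) (s≤s z≤n)) (uv refl (cong suc e) (s≤s z≤n)) ⟩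
           p₀ * q (suc i) j * (u₀ * v (suc i) j) + p (suc i) j * q₀ * (u (suc i) j * v₀)
             ≡⟨ re′ p₀ v₀ (q (suc i) j) (u (suc i) j) (p (suc i) j) (v (suc i) j) q₀ u₀ ⟩
           p₀ * u₀ * (q (suc i) j * v (suc i) j) + p (suc i) j * u (suc i) j * (q₀ * v₀) ∎) ⟩
    ∑ d (λ i j → p₀ * u₀ * (q (suc i) j * v (suc i) j) + p (suc i) j * u (suc i) j * (q₀ * v₀))
      ≡⟨ merge (p₀ * u₀) (q₀ * v₀) _ _ ⟨
    p₀ * u₀ * QV + PU * (q₀ * v₀) ∎
    where
    re : ∀ p₀ v₀ q u p v q₀ u₀ → p₀ * v₀ * (q * u) + p * v * (q₀ * u₀) ≡ p₀ * q * (u * v₀) + p * q₀ * (u₀ * v)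
    re = solve-∀
    re′ : ∀ p₀ v₀ q u p v q₀ u₀ → p₀ * q * (u₀ * v) + p * q₀ * (u * v₀) ≡ p₀ * u₀ * (q * v) + p * u * (q₀ * v₀)
    re′ = solve-∀

-- Binomial coefficients in symmetric form.

bin : ℕ → ℕ → ℕ
bin zero    j       = 1
bin (suc i) zero    = 1
bin (suc i) (suc j) = bin i (suc j) + bin (suc i) j

bin-! : ∀ i j → bin i j * (i ! * j !) ≡ (i + j) !
bin-! zero    j       = trans (*-identityˡ (1 * j !)) (*-identityˡ (j !))
bin-! (suc i) zero    = trans (lem (suc i !)) (cong (λ n → suc n !) (sym (+-identityʳ i)))
  where
  lem : ∀ x → 1 * (x * 1) ≡ x
  lem = solve-∀
bin-! (suc i) (suc j) = begin
  (bin i (suc j) + bin (suc i) j) * (suc i * i ! * (suc j * j !))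
    ≡⟨ lem (bin i (suc j)) (bin (suc i) j) i j (i !) (j !) ⟩
  suc i * (bin i (suc j) * (i ! * (suc j * j !))) + suc j * (bin (suc i) j * (suc i * i ! * j !))
    ≡⟨ cong₂ (λ x y → suc i * x + suc j * y) (bin-! i (suc j)) (bin-! (suc i) j) ⟩
  suc i * (i + suc j) ! + suc j * (suc i + j) !
    ≡⟨ cong (λ x → suc i * x ! + suc j * (suc i + j) !) (+-suc i j) ⟩
  suc i * (suc i + j) ! + suc j * (suc i + j) !
    ≡⟨ *-distribʳ-+ ((suc i + j) !) (suc i) (suc j) ⟨
  (suc i + suc j) * (suc i + j) !
    ≡⟨ cong (λ x → (suc i + suc j) * x !) (sym (+-suc i j)) ⟩
  (suc i + suc j) ! ∎
  where
  open ≡-Reasoning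
  lem : ∀ x y i j a b → (x + y) * (suc i * a * (suc j * b)) ≡ suc i * (x * (a * (suc j * b))) + suc j *
      (y * (suc i * a * b))
  lem = solve-∀

*-cancelʳ-! : ∀ i {x y} → x * i ! ≡ y * i ! → x ≡ y
*-cancelʳ-! i {x} {y} = *-cancelʳ-≡ x y (i !) {{i !≢0}}

-- Both sides are the trinomial coefficient `(i + k + l)! / (i! k! l!)`.
bin-assoc : ∀ i k l → bin i (k + l) * bin k l ≡ bin (i + k) l * bin i k
bin-assoc i k l = *-cancelʳ-! i (*-cancelʳ-! k (*-cancelʳ-! l (begin
  bin i (k + l) * bin k l * i ! * k ! * l !     ≡⟨ re (bin i (k + l)) (bin k l) (i !) (k !) (l !) ⟩
  bin i (k + l) * (i ! * (bin k l * (k ! * l !))) ≡⟨ cong (λ x → bin i (k + l) * (i ! * x)) (bin-! k l) ⟩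
  bin i (k + l) * (i ! * (k + l) !)             ≡⟨ bin-! i (k + l) ⟩
  (i + (k + l)) !                               ≡⟨ cong _! (sym (+-assoc i k l)) ⟩
  (i + k + l) !                                 ≡⟨ bin-! (i + k) l ⟨
  bin (i + k) l * ((i + k) ! * l !)             ≡⟨ cong (λ x → bin (i + k) l * (x * l !)) (bin-! i k) ⟨
  bin (i + k) l * (bin i k * (i ! * k !) * l !) ≡⟨ re′ (bin (i + k) l) (bin i k) (i !) (k !) (l !) ⟩
  bin (i + k) l * bin i k * i ! * k ! * l !     ∎)))
  where
  open ≡-Reasoning
  re : ∀ x y a b c → x * y * a * b * c ≡ x * (a * (y * (b * c)))
  re = solve-∀
  re′ : ∀ x y a b c → x * (y * (a * b) * c) ≡ x * y * a * b * c
  re′ = solve-∀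

-- Binomials of the labelled configurations whose distinguished label lies on the left, respectively right.
binˡ binʳ : ℕ → ℕ → ℕ
binˡ zero    j = 0
binˡ (suc i) j = bin i j
binʳ i zero    = 0
binʳ i (suc j) = bin i j

bin-sym : ∀ i j → bin i j ≡ bin j i
bin-sym i j = *-cancelʳ-! i (*-cancelʳ-! j (begin
  bin i j * i ! * j !   ≡⟨ *-assoc (bin i j) _ _ ⟩
  bin i j * (i ! * j !) ≡⟨ bin-! i j ⟩
  (i + j) !             ≡⟨ cong _! (+-comm i j) ⟩
  (j + i) !             ≡⟨ bin-! j i ⟨
  bin j i * (j ! * i !) ≡⟨ re (bin j i) (j !) (i !) ⟩
  bin j i * i ! * j !   ∎))
  where
  open ≡-Reasoning
  re : ∀ x a b → x * (a * b) ≡ x * b * a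
  re = solve-∀

bin-absorbˡ : ∀ i j → (i + j) * binˡ i j ≡ i * bin i j
bin-absorbˡ zero    j = *-zeroʳ j
bin-absorbˡ (suc i) j = *-cancelʳ-! i (*-cancelʳ-! j (begin
  suc (i + j) * bin i j * i ! * j !   ≡⟨ re (suc (i + j)) (bin i j) (i !) (j !) ⟩
  suc (i + j) * (bin i j * (i ! * j !)) ≡⟨ cong (suc (i + j) *_) (bin-! i j) ⟩
  suc (i + j) !                       ≡⟨ bin-! (suc i) j ⟨
  bin (suc i) j * (suc i * i ! * j !) ≡⟨ re′ (bin (suc i) j) (suc i) (i !) (j !) ⟩
  suc i * bin (suc i) j * i ! * j !   ∎))
  where
  open ≡-Reasoning
  re : ∀ n x a b → n * x * a * b ≡ n * (x * (a * b))
  re = solve-∀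
  re′ : ∀ x n a b → x * (n * a * b) ≡ n * x * a * b
  re′ = solve-∀

binʳ-flip : ∀ i j → binʳ i j ≡ binˡ j i
binʳ-flip i zero    = refl
binʳ-flip i (suc j) = bin-sym i j

bin-absorbʳ : ∀ i j → (i + j) * binʳ i j ≡ j * bin i j
bin-absorbʳ i j = begin
  (i + j) * binʳ i j ≡⟨ cong₂ _*_ (+-comm i j) (binʳ-flip i j) ⟩
  (j + i) * binˡ j i ≡⟨ bin-absorbˡ j i ⟩
  j * bin j i        ≡⟨ cong (j *_) (bin-sym j i) ⟩
  j * bin i j        ∎
  where open ≡-Reasoning

pascal : ∀ d i j → i + j ≡ suc d → bin i j ≡ binˡ i j + binʳ i j
pascal d zero    (suc j) e = refl
pascal d (suc i) zero    e = lem i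
  where
  lem : ∀ i → 1 ≡ bin i 0 + 0
  lem zero    = refl
  lem (suc i) = refl
pascal d (suc i) (suc j) e = refl

-- Polynomials, shifts, products and binomial sums.

-- A polynomial in q is its coefficient sequence.
Poly : Set
Poly = ℕ → ℕ

infix 4 _≈_ _≼_
infixr 7 _·_
infixl 7 _⊛_

_≈_ : Poly → Poly → Set
A ≈ B = ∀ k → A k ≡ B k

≈-sym : ∀ {A B} → A ≈ B → B ≈ A
≈-sym e k = sym (e k)

≈-trans : ∀ {A B C} → A ≈ B → B ≈ C → A ≈ C
≈-trans e f k = trans (e k) (f k)

_·_ : ℕ → Poly → Poly
(c · A) k = c * A k

_⊕_ : Poly → Poly → Poly
(A ⊕ B) k = A k + B k

𝟙 : Poly
𝟙 zero    = 1
𝟙 (suc _) = 0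

q·_ : Poly → Poly
(q· A) zero    = 0
(q· A) (suc k) = A k

shift : ℕ → Poly → Poly
shift zero    A = A
shift (suc n) A = q· shift n A

_⊛_ : Poly → Poly → Poly
(A ⊛ B) k = ∑ k (λ i j → A i * B j)

-- Sum over all ways to divide `d` labels into `i` of one class and `j` of another.
lin : ℕ → (ℕ → ℕ → Poly) → Poly
lin d P k = ∑ d (λ i j → bin i j * P i j k)

-- Likelihood-ratio order: the quotient B k / A k is nondecreasing in k.
record _≼_ (A B : Poly) : Set where
  constructor lr
  field ratio : ∀ {i j} → i ≤ j → A j * B i ≤ A i * B j
open _≼_

-- All pairs `i ≤ j` are asked for, not only adjacent ones: this is log-concavity without internal
-- zeros, equivalent to `A ≼ q· A`, and the form that products call for.
record LC (A : Poly) : Set where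
  constructor lc
  field concave : ∀ {i j} → i ≤ j → A i * A (suc j) ≤ A (suc i) * A j
open LC

Pos : Poly → Set
Pos A = ∃ λ k → 0 < A k

q-cong : ∀ {A B} → A ≈ B → q· A ≈ q· B
q-cong e zero    = refl
q-cong e (suc k) = e k

shift-cong : ∀ n {A B} → A ≈ B → shift n A ≈ shift n B
shift-cong zero    e = e
shift-cong (suc n) e = q-cong (shift-cong n e)

shift-+ : ∀ m n A → shift m (shift n A) ≡ shift (m + n) A
shift-+ zero    n A = refl
shift-+ (suc m) n A = cong q·_ (shift-+ m n A)

shift-q : ∀ n A → shift n (q· A) ≡ q· shift n A
shift-q n A = trans (shift-+ n 1 A) (cong (λ m → shift m A) (+-comm n 1))

q-⊕ : ∀ A B → q· (A ⊕ B) ≈ (q· A) ⊕ (q· B)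
q-⊕ A B zero    = refl
q-⊕ A B (suc k) = refl

shift-⊕ : ∀ n A B → shift n (A ⊕ B) ≈ shift n A ⊕ shift n B
shift-⊕ zero    A B k = refl
shift-⊕ (suc n) A B k = trans (q-cong (shift-⊕ n A B) k) (q-⊕ _ _ k)

shift-· : ∀ n c A → shift n (c · A) ≈ c · shift n A
shift-· zero    c A k       = refl
shift-· (suc n) c A zero    = sym (*-zeroʳ c)
shift-· (suc n) c A (suc k) = shift-· n c A k

lin-cong : ∀ d {P Q : ℕ → ℕ → Poly} → (∀ i j → i + j ≡ d → P i j ≈ Q i j) → lin d P ≈ lin d Q
lin-cong d h k = ∑-cong d λ i j e → cong (bin i j *_) (h i j e k)

lin-⊕ : ∀ d P Q → lin d (λ i j → P i j ⊕ Q i j) ≈ lin d P ⊕ lin d Q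
lin-⊕ d P Q k = trans (∑-cong d λ i j _ → *-distribˡ-+ (bin i j) _ _) (∑-+ d _ _)

lin-· : ∀ d c P → lin d (λ i j → c · P i j) ≈ c · lin d P
lin-· d c P k = trans (∑-cong d λ i j _ → swap (bin i j) c (P i j k)) (∑-*ˡ d c _)
  where
  swap : ∀ a b c → a * (b * c) ≡ b * (a * c)
  swap = solve-∀

q-lin : ∀ d P → q· lin d P ≈ lin d (λ i j → q· P i j)
q-lin d P zero    = sym (trans (∑-cong d λ i j _ → *-zeroʳ (bin i j)) (∑-zero d))
q-lin d P (suc k) = refl

shift-lin : ∀ n d P → shift n (lin d P) ≈ lin d (λ i j → shift n (P i j))
shift-lin zero    d P k = refl
shift-lin (suc n) d P k = trans (q-cong (shift-lin n d P) k) (q-lin d _ k)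

lin-assoc : ∀ d (Φ : ℕ → ℕ → ℕ → Poly) →
            lin d (λ i j → lin j (λ k l → Φ i k l)) ≈ lin d (λ m l → lin m (λ i k → Φ i k l))
lin-assoc d Φ c = begin
  ∑ d (λ i j → bin i j * ∑ j (λ k l → bin k l * Φ i k l c))
    ≡⟨ ∑-cong d (λ i j _ → sym (∑-*ˡ j (bin i j) _)) ⟩
  ∑ d (λ i j → ∑ j (λ k l → bin i j * (bin k l * Φ i k l c)))
    ≡⟨ ∑-cong d (λ i j _ → ∑-cong j λ { k l refl → coeffs i k l }) ⟩
  ∑ d (λ i j → ∑ j (λ k l → bin (i + k) l * (bin i k * Φ i k l c)))
    ≡⟨ ∑-assoc d _ ⟩
  ∑ d (λ m l → ∑ m (λ i k → bin (i + k) l * (bin i k * Φ i k l c)))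
    ≡⟨ ∑-cong d (λ m l _ → trans (∑-cong m λ { i k refl → refl }) (∑-*ˡ m (bin m l) _)) ⟩
  ∑ d (λ m l → bin m l * ∑ m (λ i k → bin i k * Φ i k l c)) ∎
  where
  open ≡-Reasoning
  coeffs : ∀ i k l → bin i (k + l) * (bin k l * Φ i k l c) ≡ bin (i + k) l * (bin i k * Φ i k l c)
  coeffs i k l = trans (sym (*-assoc (bin i (k + l)) _ _))
                 (trans (cong (_* Φ i k l c) (bin-assoc i k l)) (*-assoc (bin (i + k) l) _ _))

⊛-comm : ∀ A B → A ⊛ B ≈ B ⊛ A
⊛-comm A B k = trans (∑-flip k _) (∑-cong k λ i j _ → *-comm (A j) (B i))

⊛-cong : ∀ {A A′ B B′} → A ≈ A′ → B ≈ B′ → A ⊛ B ≈ A′ ⊛ B′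
⊛-cong e f k = ∑-cong k λ i j _ → cong₂ _*_ (e i) (f j)

𝟙-⊛ : ∀ A → 𝟙 ⊛ A ≈ A
𝟙-⊛ A zero    = *-identityˡ (A 0)
𝟙-⊛ A (suc k) = trans (cong₂ _+_ (*-identityˡ (A (suc k))) (∑-zero k)) (+-identityʳ _)

⊛-𝟙 : ∀ A → A ⊛ 𝟙 ≈ A
⊛-𝟙 A = ≈-trans (⊛-comm A 𝟙) (𝟙-⊛ A)

q-⊛ : ∀ A B → (q· A) ⊛ B ≈ q· (A ⊛ B)
q-⊛ A B zero    = refl
q-⊛ A B (suc k) = refl

shift-⊛ : ∀ n A B → shift n A ⊛ B ≈ shift n (A ⊛ B)
shift-⊛ zero    A B k = refl
shift-⊛ (suc n) A B k = trans (q-⊛ (shift n A) B k) (q-cong (shift-⊛ n A B) k)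

⊛-shift : ∀ n A B → A ⊛ shift n B ≈ shift n (A ⊛ B)
⊛-shift n A B = ≈-trans (⊛-comm A _) (≈-trans (shift-⊛ n B A) (shift-cong n (⊛-comm B A)))

lin-⊛ : ∀ d P B → lin d P ⊛ B ≈ lin d (λ i j → P i j ⊛ B)
lin-⊛ d P B k = begin
  ∑ k (λ u v → ∑ d (λ i j → bin i j * P i j u) * B v)   ≡⟨ ∑-cong k (λ u v _ → sym (∑-*ʳ d (B v) _)) ⟩
  ∑ k (λ u v → ∑ d (λ i j → bin i j * P i j u * B v))   ≡⟨ ∑-swap k d _ ⟩
  ∑ d (λ i j → ∑ k (λ u v → bin i j * P i j u * B v))
    ≡⟨ ∑-cong d (λ i j _ → trans (∑-cong k λ u v _ → *-assoc (bin i j) _ _) (∑-*ˡ k (bin i j) _)) ⟩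
  ∑ d (λ i j → bin i j * ∑ k (λ u v → P i j u * B v))   ∎
  where open ≡-Reasoning

⊛-lin : ∀ d A P → A ⊛ lin d P ≈ lin d (λ i j → A ⊛ P i j)
⊛-lin d A P = ≈-trans (⊛-comm A _) (≈-trans (lin-⊛ d P A) (lin-cong d λ i j _ → ⊛-comm (P i j) A))

·-⊛ : ∀ c A B → (c · A) ⊛ B ≈ c · (A ⊛ B)
·-⊛ c A B k = trans (∑-cong k λ i j _ → *-assoc c (A i) (B j)) (∑-*ˡ k c _)

⊛-· : ∀ c A B → A ⊛ (c · B) ≈ c · (A ⊛ B)
⊛-· c A B = ≈-trans (⊛-comm A _) (≈-trans (·-⊛ c B A) (λ k → cong (c *_) (⊛-comm B A k)))

⊛-⊕ : ∀ A B C → A ⊛ (B ⊕ C) ≈ (A ⊛ B) ⊕ (A ⊛ C)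
⊛-⊕ A B C k = trans (∑-cong k λ i j _ → *-distribˡ-+ (A i) _ _) (∑-+ k _ _)

-- Calculus of the likelihood-ratio order.

≼-resp : ∀ {A A′ B B′} → A ≈ A′ → B ≈ B′ → A ≼ B → A′ ≼ B′
≼-resp e f (lr h) = lr λ {i} {j} l → subst₂ _≤_ (cong₂ _*_ (e j) (f i)) (cong₂ _*_ (e i) (f j)) (h l)

zero-≼ : ∀ {A B} → (∀ k → A k ≡ 0) → A ≼ B
zero-≼ {A} {B} h = lr λ {i} {j} _ → subst (λ a → a * B i ≤ A i * B j) (sym (h j)) z≤n

≼-zero : ∀ {A B} → (∀ k → B k ≡ 0) → A ≼ B
≼-zero {A} {B} h = lr λ {i} {j} _ → ≤-trans (≤-reflexive (trans (cong (A j *_) (h i)) (*-zeroʳ (A j)))) z≤n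

private
  vanish : ∀ x {b} y → x * suc b ≤ y * 0 → x ≡ 0
  vanish zero    y h = refl
  vanish (suc x) {b} y h = contradiction (subst (suc x * suc b ≤_) (*-zeroʳ y) h) λ ()

  collapse : ∀ {x} y {z} → x ≡ 0 → x * y ≤ z
  collapse y refl = z≤n

  collapseʳ : ∀ x {y z} → y ≡ 0 → x * y ≤ z
  collapseʳ x refl = ≤-trans (≤-reflexive (*-zeroʳ x)) z≤n

  cancel₂ : ∀ {x y} a b → x * (suc a * suc b) ≤ y * (suc a * suc b) → x ≤ y
  cancel₂ {x} {y} a b = *-cancelʳ-≤ x y (suc a * suc b)

-- The middle term must not vanish identically, since 0 ≼ and ≼ 0 always hold.
≼-trans : ∀ {A B C} → A ≼ B → Pos B → B ≼ C → A ≼ C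
≼-trans {A} {B} {C} (lr ab) (k , pos) (lr bc) = lr go
  where
  go : ∀ {i j} → i ≤ j → A j * C i ≤ A i * C j
  go {i} {j} i≤j with B i in ei | B j in ej
  ... | suc b | suc c = cancel₂ b c (begin
    A j * C i * (suc b * suc c)   ≡⟨ re (A j) (C i) (suc b) (suc c) ⟩
    A j * suc b * (suc c * C i)   ≤⟨ *-mono-≤ (subst₂ (λ x y → A j * x ≤ A i * y) ei ej (ab i≤j))
        (subst₂ (λ x y → y * C i ≤ x * C j) ei ej (bc i≤j)) ⟩
    A i * suc c * (suc b * C j)   ≡⟨ re′ (A i) (C j) (suc b) (suc c) ⟩
    A i * C j * (suc b * suc c)   ∎)
    where
    open ≤-Reasoning
    re : ∀ x y b c → x * y * (b * c) ≡ x * b * (c * y)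
    re = solve-∀
    re′ : ∀ x y b c → x * c * (b * y) ≡ x * y * (b * c)
    re′ = solve-∀
  ... | suc b | zero  = collapse (C i) (vanish (A j) (A i) (subst₂ (λ x y → A j * x ≤ A i * y) ei ej (ab i≤j)))
  ... | zero  | suc c = collapseʳ (A j)
      (vanish (C i) (C j) (subst₂ _≤_ (trans (cong (_* C i) ej) (*-comm (suc c) (C i)))
      (trans (cong (_* C j) ei) (*-comm 0 (C j))) (bc i≤j)))
  ... | zero  | zero with ≤-total k j | B k in ek
  ...   | _        | zero  = contradiction pos (n≮0 {0})
  ...   | inj₁ k≤j | suc b = collapse (C i) (vanish (A j) (A k) (subst₂ (λ x y → A j * x ≤ A k * y) ek ej (ab k≤j)))
  ...   | inj₂ j≤k | suc b = collapseʳ (A j)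
      (vanish (C i) (C k) (subst₂ _≤_ (trans (cong (_* C i) ek) (*-comm (suc b) (C i)))
      (trans (cong (_* C k) ei) (*-comm 0 (C k))) (bc (≤-trans i≤j j≤k))))

-- The composite of `A ≼ B` and `B ≼ q· B`. Zeros are treated in place: log-concavity excludes them
-- between positive entries of `B`, and if `B` is identically zero then so is `q· B`.
≼-qʳ : ∀ {A B} → A ≼ B → LC B → A ≼ q· B
≼-qʳ {A} {B} (lr ab) (lc b) = lr go
  where
  go : ∀ {i j} → i ≤ j → A j * (q· B) i ≤ A i * (q· B) j
  go {zero}  {j}     _         = collapseʳ (A j) refl
  go {suc i} {suc j} (s≤s i≤j) with B (suc i) in ei | B (suc j) in ej
  ... | suc x | suc y = cancel₂ x y (begin
    A (suc j) * B i * (suc x * suc y)     ≡⟨ re (A (suc j)) (B i) (suc x) (suc y) ⟩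
    A (suc j) * suc x * (B i * suc y)     ≤⟨ *-mono-≤
        (subst₂ (λ u v → A (suc j) * u ≤ A (suc i) * v) ei ej (ab (s≤s i≤j)))
        (subst₂ (λ u v → B i * v ≤ u * B j) ei ej (b i≤j)) ⟩
    A (suc i) * suc y * (suc x * B j)     ≡⟨ re′ (A (suc i)) (B j) (suc x) (suc y) ⟩
    A (suc i) * B j * (suc x * suc y)     ∎)
    where
    open ≤-Reasoning
    re : ∀ x y b c → x * y * (b * c) ≡ x * b * (y * c)
    re = solve-∀
    re′ : ∀ x y b c → x * c * (b * y) ≡ x * y * (b * c)
    re′ = solve-∀
  ... | suc x | zero  = collapse (B i)
      (vanish (A (suc j)) (A (suc i)) (subst₂ (λ u v → A (suc j) * u ≤ A (suc i) * v) ei ej (ab (s≤s i≤j))))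
  ... | zero  | y     with B (suc j) in ej′
  ...   | zero  = ≤-trans (ab (m≤n⇒m≤1+n i≤j)) (collapseʳ (A i) ej′)
  ...   | suc z = collapseʳ (A (suc j))
      (vanish (B i) (B j) (subst₂ _≤_ (cong (B i *_) ej′) (trans (cong (_* B j) ei) (*-comm 0 (B j))) (b i≤j)))

-- Here the route is `A ≼ q· A ≼ q· B`, so log-concavity is asked of the smaller side.
≼-qˡ : ∀ {A B} → A ≼ B → LC A → A ≼ q· B
≼-qˡ {A} {B} (lr ab) (lc a) = lr go
  where
  go : ∀ {i j} → i ≤ j → A j * (q· B) i ≤ A i * (q· B) j
  go {zero}  {j}     _         = collapseʳ (A j) refl
  go {suc i} {suc j} (s≤s i≤j) with A i in ei | A j in ej
  ... | suc x | suc y = cancel₂ x y (begin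
    A (suc j) * B i * (suc x * suc y)     ≡⟨ re (A (suc j)) (B i) (suc x) (suc y) ⟩
    suc x * A (suc j) * (suc y * B i)     ≤⟨ *-mono-≤
        (subst₂ (λ u v → u * A (suc j) ≤ A (suc i) * v) ei ej (a i≤j))
        (subst₂ (λ u v → v * B i ≤ u * B j) ei ej (ab i≤j)) ⟩
    A (suc i) * suc y * (suc x * B j)     ≡⟨ re′ (A (suc i)) (B j) (suc x) (suc y) ⟩
    A (suc i) * B j * (suc x * suc y)     ∎)
    where
    open ≤-Reasoning
    re : ∀ x y b c → x * y * (b * c) ≡ b * x * (c * y)
    re = solve-∀
    re′ : ∀ x y b c → x * c * (b * y) ≡ x * y * (b * c)
    re′ = solve-∀
  ... | suc x | zero  = collapse (B i)
      (vanish (A (suc j)) (A (suc i))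
      (subst₂ _≤_ (trans (cong (_* A (suc j)) ei) (*-comm (suc x) _)) (cong (A (suc i) *_) ej) (a i≤j)))
  ... | zero  | y     = ≤-trans (ab (m≤n⇒m≤1+n i≤j)) (collapse (B (suc j)) ei)

LC⇒≼q : ∀ {A} → LC A → A ≼ q· A
LC⇒≼q {A} a = ≼-qˡ {A} {A} (lr λ {i} {j} _ → ≤-reflexive (*-comm (A j) (A i))) a

≼q⇒LC : ∀ {A} → A ≼ q· A → LC A
≼q⇒LC {A} (lr h) = lc λ {i} {j} i≤j → subst (_≤ A (suc i) * A j) (*-comm (A (suc j)) (A i)) (h (s≤s i≤j))

LC-resp : ∀ {A B} → A ≈ B → LC A → LC B
LC-resp e (lc h) = lc λ {i} {j} l → subst₂ _≤_ (cong₂ _*_ (e i) (e (suc j))) (cong₂ _*_ (e (suc i)) (e j)) (h l)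

q-≼ : ∀ {A B} → A ≼ B → q· A ≼ q· B
q-≼ {A} {B} (lr h) = lr go
  where
  go : ∀ {i j} → i ≤ j → (q· A) j * (q· B) i ≤ (q· A) i * (q· B) j
  go {zero}  {j}     _       = collapseʳ ((q· A) j) refl
  go {suc i} {suc j} (s≤s l) = h l

shift-≼ : ∀ n {A B} → A ≼ B → shift n A ≼ shift n B
shift-≼ zero    h = h
shift-≼ (suc n) h = q-≼ (shift-≼ n h)

LC-shift : ∀ n {A} → LC A → LC (shift n A)
LC-shift n {A} a = ≼q⇒LC (subst (shift n A ≼_) (shift-q n A) (shift-≼ n (LC⇒≼q a)))

·-≼ : ∀ c {A B} → A ≼ B → c · A ≼ B
·-≼ c {A} {B} (lr h) = lr λ {i} {j} l →
  subst₂ _≤_ (sym (*-assoc c (A j) (B i))) (sym (*-assoc c (A i) (B j))) (*-monoʳ-≤ c (h l))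

≼-· : ∀ c {A B} → A ≼ B → A ≼ c · B
≼-· c {A} {B} (lr h) = lr λ {i} {j} l →
  subst₂ _≤_ (re c (A j) (B i)) (re c (A i) (B j)) (*-monoʳ-≤ c (h l))
  where
  re : ∀ c x y → c * (x * y) ≡ x * (c * y)
  re = solve-∀

≼-⊕ : ∀ {A B C} → A ≼ B → A ≼ C → A ≼ B ⊕ C
≼-⊕ {A} {B} {C} (lr h) (lr h′) = lr λ {i} {j} l →
  subst₂ _≤_ (sym (*-distribˡ-+ (A j) (B i) (C i))) (sym (*-distribˡ-+ (A i) (B j) (C j))) (+-mono-≤ (h l) (h′ l))

lin-≼ : ∀ d {P B} → (∀ i j → i + j ≡ d → P i j ≼ B) → lin d P ≼ B
lin-≼ d {P} {B} h = lr λ {x} {y} l → subst₂ _≤_ (∑-*ʳ d (B x) _) (∑-*ʳ d (B y) _)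
  (∑-mono d λ i j e → _≼_.ratio (·-≼ (bin i j) (h i j e)) l)

≼-lin : ∀ d {A P} → (∀ i j → i + j ≡ d → A ≼ P i j) → A ≼ lin d P
≼-lin d {A} {P} h = lr λ {x} {y} l → subst₂ _≤_ (∑-*ˡ d (A y) _) (∑-*ˡ d (A x) _)
  (∑-mono d λ i j e → _≼_.ratio (≼-· (bin i j) (h i j e)) l)

-- Log-concave sequences, their Toeplitz matrices, and products.

-- Each use of concavity moves the outer two indices one step inwards and keeps their sum.
LC₄ : ∀ {C} → LC C → ∀ e p r → p ≤ r → C e * C (e + p + r) ≤ C (e + p) * C (e + r)
LC₄ {C} (lc c) e zero    r p≤r = ≤-reflexive
    (cong₂ (λ x y → C x * C y) (sym (+-identityʳ e)) (cong (_+ r) (+-identityʳ e)))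
LC₄ {C} (lc c) e (suc p) r p<r = begin
  C e * C (e + suc p + r)           ≡⟨ cong (λ x → C e * C x) (re e p r) ⟩
  C e * C (e + p + suc r)           ≤⟨ LC₄ {C} (lc c) e p (suc r) (m≤n⇒m≤1+n (<⇒≤ p<r)) ⟩
  C (e + p) * C (e + suc r)         ≡⟨ cong (λ x → C (e + p) * C x) (+-suc e r) ⟩
  C (e + p) * C (suc (e + r))       ≤⟨ c (+-monoʳ-≤ e (<⇒≤ p<r)) ⟩
  C (suc (e + p)) * C (e + r)       ≡⟨ cong (λ x → C x * C (e + r)) (+-suc e p) ⟨
  C (e + suc p) * C (e + r)         ∎
  where
  open ≤-Reasoning
  re : ∀ e p r → e + suc p + r ≡ e + p + suc r
  re = solve-∀

LC₄′ : ∀ {C} → LC C → ∀ e p r → C e * C (e + p + r) ≤ C (e + p) * C (e + r)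
LC₄′ {C} c e p r with ≤-total p r
... | inj₁ p≤r = LC₄ c e p r p≤r
... | inj₂ r≤p = subst₂ _≤_ (cong (λ x → C e * C x) (re e r p)) (*-comm (C (e + r)) (C (e + p))) (LC₄ c e r p r≤p)
  where
  re : ∀ e r p → e + r + p ≡ e + p + r
  re = solve-∀

-- toeplitz C k x is C (k - x), read as 0 when x > k.
toeplitz : Poly → ℕ → ℕ → ℕ
toeplitz C k       zero    = C k
toeplitz C zero    (suc x) = 0
toeplitz C (suc k) (suc x) = toeplitz C k x

-- Padding with zeros lets the coefficients of index `k` and of index `l` be summed over the same
-- range, as `∑-CauchyBinet` demands.
∑-toeplitz : ∀ (a : ℕ → ℕ) C {k l} → k ≤ l → ∑ k (λ x y → a x * C y) ≡ ∑ l (λ x _ → a x * toeplitz C k x)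
∑-toeplitz a C {zero}  {zero}  _       = refl
∑-toeplitz a C {zero}  {suc l} _       = sym
    (trans (cong (a 0 * C 0 +_) (trans (∑-cong l λ i _ _ → *-zeroʳ (a (suc i))) (∑-zero l))) (+-identityʳ _))
∑-toeplitz a C {suc k} {suc l} (s≤s h) = cong (a 0 * C (suc k) +_) (∑-toeplitz (λ x → a (suc x)) C h)

toeplitz-+ : ∀ C y e → toeplitz C (y + e) y ≡ C e
toeplitz-+ C zero    zero    = refl
toeplitz-+ C zero    (suc e) = refl
toeplitz-+ C (suc y) e       = toeplitz-+ C y e

toeplitz-> : ∀ C {k y} → k < y → toeplitz C k y ≡ 0
toeplitz-> C {zero}  {suc y} _       = refl
toeplitz-> C {suc k} {suc y} (s≤s h) = toeplitz-> C h

-- The Toeplitz matrix of a log-concave sequence is totally positive of order 2. Removing the common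
-- shift reduces to `x = 0`, where the minor either has a zero entry or is an instance of `LC₄′`.
toeplitz-minor : ∀ {C} → LC C → ∀ {k l x y} → k ≤ l → x < y →
                 toeplitz C k y * toeplitz C l x ≤ toeplitz C k x * toeplitz C l y
toeplitz-minor {C} c {zero}  {l}     {x}     {suc y} k≤l x<y = z≤n
toeplitz-minor {C} c {suc k} {suc l} {suc x} {suc y} (s≤s k≤l) (s≤s x<y) = toeplitz-minor c k≤l x<y
toeplitz-minor {C} c {suc k} {suc l} {zero}  {suc y} (s≤s k≤l) _ with y ≤? k
... | no  y≰k = collapse (C (suc l)) (toeplitz-> C (≰⇒> y≰k))
... | yes y≤k with m≤n⇒∃[o]m+o≡n y≤k | m≤n⇒∃[o]m+o≡n k≤l
...   | e , refl | r , refl = begin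
    toeplitz C (y + e) y * C (suc (y + e + r)) ≡⟨ cong₂ _*_ (toeplitz-+ C y e) (cong C (re₁ y e r)) ⟩
    C e * C (e + suc y + r)                    ≤⟨ LC₄′ c e (suc y) r ⟩
    C (e + suc y) * C (e + r)                  ≡⟨ cong₂ _*_ (cong C (re₂ e y))
        (sym (trans (cong (λ z → toeplitz C z y) (+-assoc y e r)) (toeplitz-+ C y (e + r)))) ⟩
    C (suc (y + e)) * toeplitz C (y + e + r) y ∎
    where
    open ≤-Reasoning
    re₁ : ∀ y e r → suc (y + e + r) ≡ e + suc y + r
    re₁ = solve-∀
    re₂ : ∀ e y → e + suc y ≡ suc (y + e)
    re₂ = solve-∀

-- Multiplying by `C` applies its Toeplitz matrix, so Cauchy-Binet combines the minors of `A` and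
-- `B` with those of that matrix.
⊛-≼ˡ : ∀ {A B C} → A ≼ B → LC C → A ⊛ C ≼ B ⊛ C
⊛-≼ˡ {A} {B} {C} (lr h) c = lr λ {k} {l} k≤l →
  subst₂ _≤_
    (cong₂ _*_ (sym (∑-toeplitz A C (≤-refl {l}))) (sym (∑-toeplitz B C k≤l)))
    (cong₂ _*_ (sym (∑-toeplitz A C k≤l)) (sym (∑-toeplitz B C (≤-refl {l}))))
    (∑-CauchyBinet l (λ x _ → A x) (λ x _ → B x) (λ x _ → toeplitz C k x) (λ x _ → toeplitz C l x)
      (λ _ _ x<y → h (<⇒≤ x<y)) (λ _ _ → toeplitz-minor c k≤l))

⊛-≼ʳ : ∀ {A B C} → A ≼ B → LC C → C ⊛ A ≼ C ⊛ B
⊛-≼ʳ {A} {B} {C} h c = ≼-resp (⊛-comm A C) (⊛-comm B C) (⊛-≼ˡ h c)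

-- Placements under guards and their decomposition at a level.

-- reached r u is 1 if r ≤ u and 0 otherwise; missed r u is 1 if r = u + 1 and 0 otherwise.
reached : ℕ → ℕ → ℕ
reached zero    u       = 1
reached (suc r) zero    = 0
reached (suc r) (suc u) = reached r u

missed : ℕ → ℕ → ℕ
missed zero          u       = 0
missed (suc zero)    zero    = 1
missed (suc (suc r)) zero    = 0
missed (suc r)       (suc u) = missed r u

reached-suc : ∀ r u → reached r (suc u) ≡ reached r u + missed r u
reached-suc zero          u       = refl
reached-suc (suc zero)    zero    = refl
reached-suc (suc (suc r)) zero    = refl
reached-suc (suc zero)    (suc u) = refl
reached-suc (suc (suc r)) (suc u) = reached-suc (suc r) u

reached? : ∀ r u → (r ≤ u × reached r u ≡ 1) ⊎ (u < r × reached r u ≡ 0)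
reached? zero    u       = inj₁ (z≤n , refl)
reached? (suc r) zero    = inj₂ (s≤s z≤n , refl)
reached? (suc r) (suc u) with reached? r u
... | inj₁ (l , e) = inj₁ (s≤s l , e)
... | inj₂ (l , e) = inj₂ (s≤s l , e)

missed? : ∀ r u → r ≡ suc u ⊎ missed r u ≡ 0
missed? zero          u       = inj₂ refl
missed? (suc zero)    zero    = inj₁ refl
missed? (suc (suc r)) zero    = inj₂ refl
missed? (suc r)       (suc u) with missed? r u
... | inj₁ e = inj₁ (cong suc e)
... | inj₂ e = inj₂ (trans (lem r u) e)
  where
  lem : ∀ r u → missed (suc r) (suc u) ≡ missed r u
  lem zero    u = refl
  lem (suc r) u = refl

-- Placements of d labels on the levels 0, …, length rs, with s further labels below level 0: the i-th
-- guard r asks for at least r labels on or below level i.  Here b labels go to level 0 and a above it.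
K : List ℕ → ℕ → ℕ → Poly
K []       s d = 𝟙
K (r ∷ rs) s d = lin d (λ b a → reached r (s + b) · shift a (K rs (s + b) a))

K-zero : ∀ rs s k → K rs s 0 (suc k) ≡ 0
K-zero []       s k = refl
K-zero (r ∷ rs) s k = trans (+-identityʳ _)
    (trans (cong (reached r (s + 0) *_) (K-zero rs (s + 0) k)) (*-zeroʳ (reached r (s + 0))))

distrib : ∀ n d (c : ℕ → ℕ → ℕ) (P : ℕ → ℕ → Poly) →
          shift n (lin d (λ i j → c i j · P i j)) ≈ lin d (λ i j → c i j · shift n (P i j))
distrib n d c P k = trans (shift-lin n d _ k) (lin-cong d (λ i j _ → shift-· n (c i j) (P i j)) k)

push : ∀ c n d (c′ : ℕ → ℕ → ℕ) (P : ℕ → ℕ → Poly) →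
       c · shift n (lin d (λ i j → c′ i j · P i j)) ≈ lin d (λ i j → c · (c′ i j · shift n (P i j)))
push c n d c′ P k = trans (cong (c *_) (distrib n d c′ P k)) (sym (lin-· d c (λ i j → c′ i j · shift n (P i j)) k))

lin-⊛′ : ∀ d (c e : ℕ → ℕ → ℕ) (P : ℕ → ℕ → Poly) R →
         lin d (λ i j → c i j · shift (e i j) (P i j)) ⊛ R ≈ lin d (λ i j → c i j · shift (e i j) (P i j ⊛ R))
lin-⊛′ d c e P R = ≈-trans (lin-⊛ d _ R) (lin-cong d λ i j _ k →
  trans (·-⊛ (c i j) _ R k) (cong (c i j *_) (shift-⊛ (e i j) (P i j) R k)))

⊛-lin′ : ∀ d (c e : ℕ → ℕ → ℕ) (P : ℕ → ℕ → Poly) R →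
         R ⊛ lin d (λ i j → c i j · shift (e i j) (P i j)) ≈ lin d (λ i j → c i j · shift (e i j) (R ⊛ P i j))
⊛-lin′ d c e P R = ≈-trans (⊛-lin d R _) (lin-cong d λ i j _ k →
  trans (⊛-· (c i j) R _ k) (cong (c i j *_) (⊛-shift (e i j) R (P i j) k)))

shift-shift : ∀ {m n p} A → m + n ≡ p → shift m (shift n A) ≈ shift p A
shift-shift {m} {n} A refl k = cong (λ B → B k) (shift-+ m n A)

·-swap : ∀ a b {A B : Poly} → A ≈ B → a · (b · A) ≈ b · (a · B)
·-swap a b {A} e k = trans (swap a b (A k)) (cong (λ x → b * (a * x)) (e k))
  where
  swap : ∀ a b c → a * (b * c) ≡ b * (a * c)
  swap = solve-∀

-- The `x` labels on the first `suc (length xs)` levels see the guards `xs`, and `r` only through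
-- their number. The other `a` labels all sit `suc (length xs)` levels higher and regard those `x`
-- as lying below them. For fixed `x` the two groups are independent, hence the product.
cut : ∀ xs r ys s d → K (xs ++ r ∷ ys) s d ≈
      lin d (λ x a → reached r (s + x) · shift (suc (length xs) * a) (K xs s x ⊛ K ys (s + x) a))
cut [] r ys s d = lin-cong d λ x a _ k → cong (reached r (s + x) *_)
  (trans (cong (λ n → shift n (K ys (s + x) a) k) (sym (*-identityˡ a)))
         (shift-cong (1 * a) (≈-sym (𝟙-⊛ (K ys (s + x) a))) k))
cut (x₀ ∷ xs) r ys s d = ≈-trans (lin-cong d split) (≈-trans (lin-assoc d Φ) (lin-cong d regroup))
  where
  t = suc (length xs)
  Φ : ℕ → ℕ → ℕ → Poly
  Φ b x a = reached x₀ (s + b) · (reached r (s + (b + x)) · shift (x + a + t * a)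
      (K xs (s + b) x ⊛ K ys (s + (b + x)) a))
  split : ∀ b a → b + a ≡ d → reached x₀ (s + b) · shift a (K (xs ++ r ∷ ys) (s + b) a) ≈ lin a (λ x a′ → Φ b x a′)
  split b a _ = ≈-trans (λ k → cong (reached x₀ (s + b) *_) (shift-cong a (cut xs r ys (s + b) a) k))
    (≈-trans (push (reached x₀ (s + b)) a a (λ x _ → reached r (s + b + x))
        (λ x a′ → shift (t * a′) (K xs (s + b) x ⊛ K ys (s + b + x) a′)))
      (lin-cong a λ { x a′ refl k → cong (reached x₀ (s + b) *_) (term b x a′ k) }))
    where
    term : ∀ b x a′ → reached r (s + b + x) · shift (x + a′) (shift (t * a′) (K xs (s + b) x ⊛ K ys (s + b + x) a′)) ≈
           reached r (s + (b + x)) · shift (x + a′ + t * a′) (K xs (s + b) x ⊛ K ys (s + (b + x)) a′)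
    term b x a′ k rewrite +-assoc s b x = cong (reached r (s + (b + x)) *_)
        (shift-shift {x + a′} {t * a′} (K xs (s + b) x ⊛ K ys (s + (b + x)) a′) refl k)
  regroup : ∀ m a → m + a ≡ d → lin m (λ b x → Φ b x a) ≈
            reached r (s + m) · shift (suc t * a) (K (x₀ ∷ xs) s m ⊛ K ys (s + m) a)
  regroup m a _ = ≈-sym (≈-trans
    (λ k → cong (reached r (s + m) *_)
        (shift-cong (suc t * a) (lin-⊛′ m (λ b _ → reached x₀ (s + b)) (λ _ x → x) (λ b x → K xs (s + b) x)
        (K ys (s + m) a)) k))
    (≈-trans (push (reached r (s + m)) (suc t * a) m (λ b _ → reached x₀ (s + b))
        (λ b x → shift x (K xs (s + b) x ⊛ K ys (s + m) a)))
      (lin-cong m λ { b x refl → ·-swap (reached r (s + (b + x))) (reached x₀ (s + b))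
        (shift-shift {suc t * a} {x} (K xs (s + b) x ⊛ K ys (s + (b + x)) a) (re t a x)) })))
    where
    re : ∀ t a x → suc t * a + x ≡ x + a + t * a
    re = solve-∀

peel : ∀ xs r s d → K (xs ++ [ r ]) s d ≈
       lin d (λ x a → reached r (s + x) · shift (suc (length xs) * a) (K xs s x))
peel xs r s d = ≈-trans (cut xs r [] s d) (lin-cong d λ x a _ k →
  cong (reached r (s + x) *_) (shift-cong (suc (length xs) * a) (⊛-𝟙 (K xs s x)) k))

-- Moves one level from the upper factor of a split to its lower factor.
advance : ∀ xs r s d (h : ℕ → ℕ) (Z : ℕ → ℕ → Poly) →
  lin d (λ x a → reached r (s + x) · shift (suc (length xs) * a)
    (K xs s x ⊛ lin a (λ b a′ → h (s + x + b) · shift a′ (Z (s + x + b) a′)))) ≈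
  lin d (λ y a → h (s + y) · shift (suc (suc (length xs)) * a) (K (xs ++ [ r ]) s y ⊛ Z (s + y) a))
advance xs r s d h Z = ≈-trans (lin-cong d split) (≈-trans (lin-assoc d Φ) (lin-cong d regroup))
  where
  t = suc (length xs)
  Φ : ℕ → ℕ → ℕ → Poly
  Φ x b a = reached r (s + x) · (h (s + (x + b)) · shift (t * (b + a) + a) (K xs s x ⊛ Z (s + (x + b)) a))
  split : ∀ x a → x + a ≡ d → reached r (s + x) · shift (t * a)
            (K xs s x ⊛ lin a (λ b a′ → h (s + x + b) · shift a′ (Z (s + x + b) a′))) ≈ lin a (λ b a′ → Φ x b a′)
  split x a _ = ≈-trans (λ k → cong (reached r (s + x) *_)
      (shift-cong (t * a) (⊛-lin′ a (λ b _ → h (s + x + b)) (λ _ a′ → a′) (λ b a′ → Z (s + x + b) a′) (K xs s x)) k))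
    (≈-trans (push (reached r (s + x)) (t * a) a (λ b _ → h (s + x + b))
        (λ b a′ → shift a′ (K xs s x ⊛ Z (s + x + b) a′)))
      (lin-cong a λ { b a′ refl k → cong (reached r (s + x) *_) (term b a′ k) }))
    where
    term : ∀ b a′ → h (s + x + b) · shift (t * (b + a′)) (shift a′ (K xs s x ⊛ Z (s + x + b) a′)) ≈
           h (s + (x + b)) · shift (t * (b + a′) + a′) (K xs s x ⊛ Z (s + (x + b)) a′)
    term b a′ k rewrite +-assoc s x b = cong (h (s + (x + b)) *_)
        (shift-shift {t * (b + a′)} {a′} (K xs s x ⊛ Z (s + (x + b)) a′) refl k)
  regroup : ∀ m a → m + a ≡ d → lin m (λ x b → Φ x b a) ≈
            h (s + m) · shift (suc t * a) (K (xs ++ [ r ]) s m ⊛ Z (s + m) a)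
  regroup m a _ = ≈-sym (≈-trans
    (λ k → cong (h (s + m) *_) (shift-cong (suc t * a)
      (≈-trans (⊛-cong (peel xs r s m) (λ _ → refl))
          (lin-⊛′ m (λ x _ → reached r (s + x)) (λ _ b → t * b) (λ x _ → K xs s x) (Z (s + m) a))) k))
    (≈-trans (push (h (s + m)) (suc t * a) m (λ x _ → reached r (s + x))
        (λ x b → shift (t * b) (K xs s x ⊛ Z (s + m) a)))
      (lin-cong m λ { x b refl → ·-swap (h (s + (x + b))) (reached r (s + x))
        (shift-shift {suc t * a} {t * b} (K xs s x ⊛ Z (s + (x + b)) a) (re t a b)) })))
    where
    re : ∀ t a b → suc t * a + t * b ≡ t * (b + a) + a
    re = solve-∀

-- When a placement polynomial vanishes.

∑-term : ∀ d f → f d 0 ≤ ∑ d f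
∑-term zero    f = ≤-refl
∑-term (suc d) f = ≤-trans (∑-term d (λ i j → f (suc i) j)) (m≤n+m _ (f 0 (suc d)))

shift-null : ∀ n {A} → (∀ k → A k ≡ 0) → ∀ k → shift n A k ≡ 0
shift-null zero    h k       = h k
shift-null (suc n) h zero    = refl
shift-null (suc n) h (suc k) = shift-null n h k

shift-Pos : ∀ n {A} → Pos A → Pos (shift n A)
shift-Pos zero    p = p
shift-Pos (suc n) p with shift-Pos n p
... | k , h = suc k , h

-- With `n` the number of all labels, those below included, this decides whether `K` is nonzero: see
-- `K-pos` and `K-null`.
Feasible : List ℕ → ℕ → Set
Feasible rs n = All (_≤ n) rs

-- The constant coefficient counts the placement of all labels on level `0`, which meets every guard
-- that can be met at all.
K-pos : ∀ rs s d → Feasible rs (s + d) → 0 < K rs s d 0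
K-pos []       s d _        = s≤s z≤n
K-pos (r ∷ rs) s d (l ∷ ls) = ≤-trans (term (reached? r (s + d))) (∑-term d _)
  where
  1≤bin : ∀ d → 1 ≤ bin d 0
  1≤bin zero    = ≤-refl
  1≤bin (suc d) = ≤-refl
  term : (r ≤ s + d × reached r (s + d) ≡ 1) ⊎ (s + d < r × reached r (s + d) ≡ 0) → 0 < bin d 0 *
      (reached r (s + d) * K rs (s + d) 0 0)
  term (inj₁ (_ , e)) rewrite e = *-mono-≤ (1≤bin d)
      (*-mono-≤ (≤-refl {1}) (K-pos rs (s + d) 0 (subst (Feasible rs) (sym (+-identityʳ (s + d))) ls)))
  term (inj₂ (g , _)) = contradiction l (<⇒≱ g)

K-null : ∀ rs s d → ¬ Feasible rs (s + d) → ∀ k → K rs s d k ≡ 0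
K-null []       s d ¬f k = contradiction [] ¬f
K-null (r ∷ rs) s d ¬f k = trans
    (∑-cong d λ { b a refl → trans (cong (bin b a *_) (term b a ¬f (reached? r (s + b)))) (*-zeroʳ (bin b a)) })
    (∑-zero d)
  where
  term : ∀ b a → ¬ Feasible (r ∷ rs) (s + (b + a)) → (r ≤ s + b × reached r (s + b) ≡ 1) ⊎
      (s + b < r × reached r (s + b) ≡ 0) → reached r (s + b) * shift a (K rs (s + b) a) k ≡ 0
  term b a ¬f (inj₂ (_ , e)) rewrite e = refl
  term b a ¬f (inj₁ (l , _)) = trans (cong (reached r (s + b) *_)
    (shift-null a (K-null rs (s + b) a λ fs → ¬f
        (≤-trans l (+-monoʳ-≤ s (m≤m+n b a)) ∷ subst (Feasible rs) (+-assoc s b a) fs)) k))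
    (*-zeroʳ (reached r (s + b)))

⊛-Pos : ∀ {A B} → 0 < A 0 → 0 < B 0 → Pos (A ⊛ B)
⊛-Pos p p′ = 0 , *-mono-≤ p p′

⊛-nullˡ : ∀ {A} B → (∀ k → A k ≡ 0) → ∀ k → (A ⊛ B) k ≡ 0
⊛-nullˡ B h k = trans (∑-cong k λ i j _ → cong (_* B j) (h i)) (∑-zero k)

⊛-nullʳ : ∀ A {B} → (∀ k → B k ≡ 0) → ∀ k → (A ⊛ B) k ≡ 0
⊛-nullʳ A h k = trans (∑-cong k λ i j _ → trans (cong (A i *_) (h j)) (*-zeroʳ (A i))) (∑-zero k)

-- Chains of comparisons and mixtures with monotone weights.

-- Positivity is asked only from `x` upwards, because terms with fewer low labels may be infeasible
-- and hence zero.
descend : ∀ {N x} (A : ℕ → ℕ → Poly) →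
  (∀ z b → x ≤ z → z + suc b ≡ N → A (suc z) b ≼ A z (suc b)) →
  (∀ z b → x ≤ z → z + b ≡ N → Pos (A z b)) →
  ∀ e a → e + x + a ≡ N → A (e + x) a ≼ A x (e + a)
descend {x = x} A step pos zero    a eq = lr λ {i} {j} _ → ≤-reflexive (*-comm (A x a j) (A x a i))
descend {N} {x} A step pos (suc e) a eq = ≼-trans (step (e + x) a (m≤n+m x e) eq′) (pos (e + x) (suc a) (m≤n+m x e) eq′)
  (subst (λ b → A (e + x) (suc a) ≼ A x b) (+-suc e a) (descend A step pos e (suc a) eq′))
  where
  eq′ : e + x + suc a ≡ N
  eq′ = trans (+-suc (e + x) a) eq

≼-refl : ∀ {A} → A ≼ A
≼-refl {A} = lr λ {i} {j} _ → ≤-reflexive (*-comm (A j) (A i))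

-- Relative to `w`, the weights `w′` favour small `i`, and small `i` carry the larger `A`; so both
-- minors in Cauchy-Binet have the same sign. The common factor `h` may vanish, which lets it carry
-- the indicator of a guard.
mixture : ∀ N (w w′ : ℕ → ℕ → ℕ) (h : ℕ → ℕ) (A : ℕ → ℕ → Poly) →
  (∀ {i j i′ j′} → i + j ≡ N → i′ + j′ ≡ N → i < i′ → w′ i′ j′ * w i j ≤ w′ i j * w i′ j′) →
  (∀ {i j i′ j′} → i + j ≡ N → i′ + j′ ≡ N → i < i′ → A i′ j′ ≼ A i j) →
  (λ k → ∑ N (λ i j → w i j * (h i * A i j k))) ≼ (λ k → ∑ N (λ i j → w′ i j * (h i * A i j k)))
mixture N w w′ h A ws As = lr λ {k} {l} k≤l → subst₂ _≤_
  (trans (cong₂ _*_ (assoc w′ k) (assoc w l)) (*-comm (S w′ k) (S w l)))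
  (trans (cong₂ _*_ (assoc w′ l) (assoc w k)) (*-comm (S w′ l) (S w k)))
  (∑-CauchyBinet N (λ i j → w′ i j * h i) (λ i j → w i j * h i) (λ i j → A i j l) (λ i j → A i j k)
    (λ {i} {j} {i′} {j′} e e′ i<i′ → subst₂ _≤_ (re (w′ i′ j′) (h i′) (w i j) (h i))
        (re′ (w′ i j) (h i) (w i′ j′) (h i′))
      (*-monoʳ-≤ (h i * h i′) (ws e e′ i<i′)))
    (λ {i} {j} {i′} {j′} e e′ i<i′ → subst (A i′ j′ l * A i j k ≤_) (*-comm (A i′ j′ k) (A i j l))
        (_≼_.ratio (As e e′ i<i′) k≤l)))
  where
  S : (ℕ → ℕ → ℕ) → Poly
  S w k = ∑ N (λ i j → w i j * (h i * A i j k))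
  assoc : ∀ (w : ℕ → ℕ → ℕ) k → ∑ N (λ i j → w i j * h i * A i j k) ≡ S w k
  assoc w k = ∑-cong N λ i j _ → *-assoc (w i j) (h i) (A i j k)
  re : ∀ a x b y → y * x * (a * b) ≡ a * x * (b * y)
  re = solve-∀
  re′ : ∀ a x b y → x * y * (a * b) ≡ a * x * (b * y)
  re′ = solve-∀

-- By `bin-absorbˡ`, `binˡ i j` is the fraction `i / (i + j)` of `bin i j`, and on a fixed
-- antidiagonal this fraction grows with `i`.
binˡ-minor : ∀ {d i j i′ j′} → i + j ≡ suc d → i′ + j′ ≡ suc d → i < i′ →
             bin i′ j′ * binˡ i j ≤ bin i j * binˡ i′ j′
binˡ-minor {d} {i} {j} {i′} {j′} e e′ i<i′ = *-cancelˡ-≤ (suc d) (begin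
  suc d * (bin i′ j′ * binˡ i j)     ≡⟨ re (suc d) (bin i′ j′) (binˡ i j) ⟩
  bin i′ j′ * (suc d * binˡ i j)     ≡⟨ cong (λ n → bin i′ j′ * (n * binˡ i j)) e ⟨
  bin i′ j′ * ((i + j) * binˡ i j)   ≡⟨ cong (bin i′ j′ *_) (bin-absorbˡ i j) ⟩
  bin i′ j′ * (i * bin i j)          ≤⟨ *-monoʳ-≤ (bin i′ j′) (*-monoˡ-≤ (bin i j) (<⇒≤ i<i′)) ⟩
  bin i′ j′ * (i′ * bin i j)         ≡⟨ re′ (bin i′ j′) i′ (bin i j) ⟩
  bin i j * (i′ * bin i′ j′)         ≡⟨ cong (bin i j *_) (bin-absorbˡ i′ j′) ⟨
  bin i j * ((i′ + j′) * binˡ i′ j′) ≡⟨ cong (λ n → bin i j * (n * binˡ i′ j′)) e′ ⟩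
  bin i j * (suc d * binˡ i′ j′)     ≡⟨ re (suc d) (bin i j) (binˡ i′ j′) ⟨
  suc d * (bin i j * binˡ i′ j′)     ∎)
  where
  open ≤-Reasoning
  re : ∀ n a b → n * (a * b) ≡ a * (n * b)
  re = solve-∀
  re′ : ∀ a n b → a * (n * b) ≡ b * (n * a)
  re′ = solve-∀

binʳ-minor : ∀ {d i j i′ j′} → i + j ≡ suc d → i′ + j′ ≡ suc d → i < i′ →
             binʳ i′ j′ * bin i j ≤ binʳ i j * bin i′ j′
binʳ-minor {d} {i} {j} {i′} {j′} e e′ i<i′ = *-cancelˡ-≤ (suc d) (begin
  suc d * (binʳ i′ j′ * bin i j)     ≡⟨ cong (λ n → n * (binʳ i′ j′ * bin i j)) e′ ⟨
  (i′ + j′) * (binʳ i′ j′ * bin i j) ≡⟨ *-assoc (i′ + j′) _ _ ⟨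
  (i′ + j′) * binʳ i′ j′ * bin i j   ≡⟨ cong (_* bin i j) (bin-absorbʳ i′ j′) ⟩
  j′ * bin i′ j′ * bin i j           ≤⟨ *-monoˡ-≤ (bin i j) (*-monoˡ-≤ (bin i′ j′) j′≤j) ⟩
  j * bin i′ j′ * bin i j            ≡⟨ re j (bin i′ j′) (bin i j) ⟩
  j * bin i j * bin i′ j′            ≡⟨ cong (_* bin i′ j′) (bin-absorbʳ i j) ⟨
  (i + j) * binʳ i j * bin i′ j′     ≡⟨ *-assoc (i + j) _ _ ⟩
  (i + j) * (binʳ i j * bin i′ j′)   ≡⟨ cong (λ n → n * (binʳ i j * bin i′ j′)) e ⟩
  suc d * (binʳ i j * bin i′ j′)     ∎)
  where
  open ≤-Reasoning
  re : ∀ n a b → n * a * b ≡ n * b * a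
  re = solve-∀
  j′≤j : j′ ≤ j
  j′≤j = +-cancelˡ-≤ i j′ j (≤-trans (+-monoˡ-≤ j′ (<⇒≤ i<i′)) (≤-reflexive (trans e′ (sym e))))

-- The left side unfolds from a sum over `suc d` labels with weights `binˡ`: one label is committed
-- to the first class.
mixˡ : ∀ d (h : ℕ → ℕ) (A : ℕ → ℕ → Poly) →
  (∀ {i j i′ j′} → i + j ≡ suc d → i′ + j′ ≡ suc d → i < i′ → A i′ j′ ≼ A i j) →
  lin d (λ i j → h (suc i) · A (suc i) j) ≼ lin (suc d) (λ i j → h i · A i j)
mixˡ d h A As = mixture (suc d) binˡ bin h A (binˡ-minor {d}) As

∑-binʳ : ∀ d (F : ℕ → ℕ → ℕ) → ∑ (suc d) (λ i j → binʳ i j * F i j) ≡ ∑ d (λ i j → bin i j * F i (suc j))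
∑-binʳ d F = trans (∑-last d (λ i j → binʳ i j * F i j)) (+-identityʳ _)

mixʳ : ∀ d (h : ℕ → ℕ) (A : ℕ → ℕ → Poly) →
  (∀ {i j i′ j′} → i + j ≡ suc d → i′ + j′ ≡ suc d → i < i′ → A i′ j′ ≼ A i j) →
  lin (suc d) (λ i j → h i · A i j) ≼ lin d (λ i j → h i · A i (suc j))
mixʳ d h A As = ≼-resp {lin (suc d) (λ i j → h i · A i j)} (λ _ → refl)
  (λ k → ∑-binʳ d (λ i j → h i * A i j k)) (mixture (suc d) bin binʳ h A (binʳ-minor {d}) As)

descend-< : ∀ {N} (A : ℕ → ℕ → Poly) {i j i′ j′} →
  (∀ z b → i ≤ z → z + suc b ≡ N → A (suc z) b ≼ A z (suc b)) →
  (∀ z b → i ≤ z → z + b ≡ N → Pos (A z b)) →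
  i + j ≡ N → i′ + j′ ≡ N → i ≤ i′ → A i′ j′ ≼ A i j
descend-< {N} A {i} {j} {i′} {j′} step pos e e′ i≤i′ with m≤n⇒∃[o]m+o≡n i≤i′
... | o , refl = subst₂ (λ x y → A x j′ ≼ A i y) (+-comm o i) eq
    (descend A step pos o j′ (trans (cong (_+ j′) (+-comm o i)) e′))
  where
  eq : o + j′ ≡ j
  eq = +-cancelˡ-≡ i _ _ (trans (sym (+-assoc i o j′)) (trans e′ (sym e)))

-- A distinguished label held on the top or on the bottom level.

LC-upto : ℕ → Set
LC-upto d = ∀ {e} → e ≤ d → ∀ rs s → LC (K rs s e)

LC-upto-≤ : ∀ {d e} → e ≤ d → LC-upto d → LC-upto e
LC-upto-≤ e≤d h l = h (≤-trans l e≤d)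

length-snoc : ∀ (xs : List ℕ) r → length (xs ++ [ r ]) ≡ suc (length xs)
length-snoc xs r = trans (length-++ xs) (+-comm (length xs) 1)

shift-*-suc : ∀ t a A → shift (t * a) (shift t A) ≡ shift (t * suc a) A
shift-*-suc t a A = trans (shift-+ (t * a) t A) (cong (λ n → shift n A) (trans (+-comm (t * a) t) (sym (*-suc t a))))

-- On the right one of `suc d` labels is held on the top level, where it adds `length rs` to the
-- total and counts towards no guard. Peeling off the last guard isolates the top level, and `mixʳ`
-- keeps the label there.
K-suc-≼-shift : ∀ {rs} → Reverse rs → ∀ s d → LC-upto d → K rs s (suc d) ≼ shift (length rs) (K rs s d)
K-suc-≼-shift []ʳ             s d h = ≼-refl
K-suc-≼-shift (xs ∶ rv ∶ʳ r) s d h =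
  ≼-resp (≈-sym (peel xs r s (suc d))) (≈-sym rhs) (mixʳ d (λ x → reached r (s + x)) A order)
  where
  t = suc (length xs)
  A : ℕ → ℕ → Poly
  A x a = shift (t * a) (K xs s x)
  rhs : shift (length (xs ++ [ r ])) (K (xs ++ [ r ]) s d) ≈ lin d (λ x a → reached r (s + x) · A x (suc a))
  rhs k = trans (cong (λ n → shift n (K (xs ++ [ r ]) s d) k) (length-snoc xs r))
    (trans (shift-cong t (peel xs r s d) k)
    (trans (distrib t d (λ x _ → reached r (s + x)) A k)
      (lin-cong d (λ x a _ k → cong (reached r (s + x) *_)
          (shift-shift {t} {t * a} (K xs s x) (sym (*-suc t a)) k)) k)))
  order : ∀ {i j i′ j′} → i + j ≡ suc d → i′ + j′ ≡ suc d → i < i′ → A i′ j′ ≼ A i j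
  -- If `s + i` labels cannot satisfy `xs`, the larger side `A i j` is zero; otherwise all `A z b`
  -- with `i ≤ z` are positive and the chain composes.
  order {i} {j} e e′ i<i′ with all? (_≤? s + i) xs
  ... | no ¬f = ≼-zero (shift-null (t * j) (K-null xs s i ¬f))
  ... | yes f = descend-< A step pos e e′ (<⇒≤ i<i′)
    where
    step : ∀ z b → i ≤ z → z + suc b ≡ suc d → A (suc z) b ≼ A z (suc b)
    -- Induction yields the exponent `length xs`; log-concavity supplies the one further factor `q`
    -- that makes it `t`.
    step z b _ eq = subst (A (suc z) b ≼_) (shift-*-suc t b (K xs s z))
      (shift-≼ (t * b) (≼-qʳ (K-suc-≼-shift rv s z (LC-upto-≤ z≤d h)) (LC-shift (length xs) (h z≤d xs s))))
      where
      z≤d : z ≤ d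
      z≤d = ≤-trans (m≤m+n z b) (≤-reflexive (suc-injective (trans (sym (+-suc z b)) eq)))
    pos : ∀ z b → i ≤ z → z + b ≡ suc d → Pos (A z b)
    pos z b i≤z _ = shift-Pos (t * b) (0 , K-pos xs s z (All-≤ f))
      where
      All-≤ : ∀ {ys} → All (_≤ s + i) ys → All (_≤ s + z) ys
      All-≤ []       = []
      All-≤ (l ∷ ls) = ≤-trans l (+-monoʳ-≤ s i≤z) ∷ All-≤ ls

-- On the left one label is held on the bottom level: it adds nothing to the total and counts
-- towards every guard, just as if it lay below all levels.
K-≼-suc : ∀ rs s d → LC-upto d → K rs (suc s) d ≼ K rs s (suc d)
K-≼-suc []       s d h = ≼-refl
K-≼-suc (r ∷ rs) s d h = ≼-resp lhs (λ _ → refl) (mixˡ d (λ x → reached r (s + x)) A order)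
  where
  A : ℕ → ℕ → Poly
  A b a = shift a (K rs (s + b) a)
  lhs : lin d (λ b a → reached r (s + suc b) · A (suc b) a) ≈ K (r ∷ rs) (suc s) d
  lhs = lin-cong d λ b a _ k → cong (λ u → reached r u * shift a (K rs u a) k) (+-suc s b)
  order : ∀ {i j i′ j′} → i + j ≡ suc d → i′ + j′ ≡ suc d → i < i′ → A i′ j′ ≼ A i j
  order {i} {j} e e′ i<i′ with all? (_≤? s + suc d) rs
  ... | no ¬f = ≼-zero (shift-null j
      (K-null rs (s + i) j (¬f ∘ subst (Feasible rs) (trans (+-assoc s i j) (cong (s +_) e)))))
  ... | yes f = descend-< A step pos e e′ (<⇒≤ i<i′)
    where
    step : ∀ z b → i ≤ z → z + suc b ≡ suc d → A (suc z) b ≼ A z (suc b)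
    step z b _ eq = subst (A (suc z) b ≼_) (shift-q b (K rs (s + z) (suc b)))
      (shift-≼ b (≼-qˡ (subst (λ u → K rs u b ≼ K rs (s + z) (suc b)) (sym (+-suc s z))
          (K-≼-suc rs (s + z) b (LC-upto-≤ b≤d h)))
                       (h b≤d rs (s + suc z))))
      where
      b≤d : b ≤ d
      b≤d = ≤-trans (m≤n+m b z) (≤-reflexive (suc-injective (trans (sym (+-suc z b)) eq)))
    pos : ∀ z b → i ≤ z → z + b ≡ suc d → Pos (A z b)
    pos z b _ eq = shift-Pos b (0 , K-pos rs (s + z) b
        (subst (Feasible rs) (sym (trans (+-assoc s z b) (cong (s +_) eq))) f))

-- The telescoping identity.

-- The ways in which raising a label fails. In the first summand the guard `r` is met by labels
-- other than the raised one and the failure occurs higher up; in the second the label leaves level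
-- `0` and `r` is short by one. The base case `q· 𝟙` is a label pushed beyond the top level.
Neg : List ℕ → ℕ → ℕ → Poly
Neg []       s d = q· 𝟙
Neg (r ∷ rs) s d = (q· lin d (λ b a → reached r (s + b) · shift a (Neg rs (s + b) a))) ⊕
                   (q· lin d (λ b a → missed r (s + b) · shift a (K rs (suc (s + b)) a)))

weighted-⊕ : ∀ d (c : ℕ → ℕ → ℕ) (P Q : ℕ → ℕ → Poly) →
             lin d (λ i j → c i j · (P i j ⊕ Q i j)) ≈ lin d (λ i j → c i j · P i j) ⊕ lin d (λ i j → c i j · Q i j)
weighted-⊕ d c P Q k = trans (lin-cong d (λ i j _ k → *-distribˡ-+ (c i j) (P i j k) (Q i j k)) k)
  (lin-⊕ d (λ i j → c i j · P i j) (λ i j → c i j · Q i j) k)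

lin-suc : ∀ d P → lin (suc d) P ≈ lin d (λ i j → P (suc i) j) ⊕ lin d (λ i j → P i (suc j))
lin-suc d P k = begin
  ∑ (suc d) (λ i j → bin i j * P i j k)
    ≡⟨ ∑-cong (suc d) (λ i j e → trans (cong (_* P i j k) (pascal d i j e))
        (*-distribʳ-+ (P i j k) (binˡ i j) (binʳ i j))) ⟩
  ∑ (suc d) (λ i j → binˡ i j * P i j k + binʳ i j * P i j k)
    ≡⟨ ∑-+ (suc d) (λ i j → binˡ i j * P i j k) (λ i j → binʳ i j * P i j k) ⟩
  ∑ d (λ i j → bin i j * P (suc i) j k) + ∑ (suc d) (λ i j → binʳ i j * P i j k)
    ≡⟨ cong (∑ d (λ i j → bin i j * P (suc i) j k) +_) (∑-binʳ d (λ i j → P i j k)) ⟩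
  ∑ d (λ i j → bin i j * P (suc i) j k) + ∑ d (λ i j → bin i j * P i (suc j) k) ∎
  where open ≡-Reasoning

-- The distinguished label lies on the bottom level or above it.
K-split : ∀ r rs s d → K (r ∷ rs) s (suc d) ≈
          K (r ∷ rs) (suc s) d ⊕ lin d (λ b a → reached r (s + b) · shift (suc a) (K rs (s + b) (suc a)))
K-split r rs s d k = trans (lin-suc d (λ b a → reached r (s + b) · shift a (K rs (s + b) a)) k)
  (cong (_+ lin d (λ b a → reached r (s + b) · shift (suc a) (K rs (s + b) (suc a))) k)
    (lin-cong d (λ b a _ k → cong (λ u → reached r u * shift a (K rs u a) k) (+-suc s b)) k))

-- (1 - q) K rs s (d + 1) = K rs (s + 1) d - Neg rs s d: raising one label by one level telescopes,
-- and Neg collects the configurations in which that label just misses a guard.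
telescope : ∀ rs s d → K rs s (suc d) ⊕ Neg rs s d ≈ (q· K rs s (suc d)) ⊕ K rs (suc s) d
telescope []       s d k = +-comm (𝟙 k) _
telescope (r ∷ rs) s d k = begin
  K (r ∷ rs) s (suc d) k + ((q· N) k + (q· Y) k)   ≡⟨ cong (_+ ((q· N) k + (q· Y) k)) (split k) ⟩
  A k + E k + ((q· N) k + (q· Y) k)                ≡⟨ re₁ (A k) (E k) ((q· N) k) ((q· Y) k) ⟩
  A k + (E k + (q· N) k) + (q· Y) k                ≡⟨ cong (λ x → A k + x + (q· Y) k) (inner k) ⟩
  A k + ((q· E) k + (q· X) k) + (q· Y) k           ≡⟨ re₂ (A k) ((q· E) k) ((q· X) k) ((q· Y) k) ⟩
  (q· X) k + (q· Y) k + (q· E) k + A k             ≡⟨ cong (λ x → x + (q· E) k + A k)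
      (trans (q-cong boundary k) (q-⊕ X Y k)) ⟨
  (q· A) k + (q· E) k + A k                        ≡⟨ cong (_+ A k) (trans (q-cong split k) (q-⊕ A E k)) ⟨
  (q· K (r ∷ rs) s (suc d)) k + A k                ∎
  where
  open ≡-Reasoning
  A = K (r ∷ rs) (suc s) d
  E = lin d (λ b a → reached r (s + b) · shift (suc a) (K rs (s + b) (suc a)))
  N = lin d (λ b a → reached r (s + b) · shift a (Neg rs (s + b) a))
  X = lin d (λ b a → reached r (s + b) · shift a (K rs (suc (s + b)) a))
  Y = lin d (λ b a → missed r (s + b) · shift a (K rs (suc (s + b)) a))
  re₁ : ∀ a e n y → a + e + (n + y) ≡ a + (e + n) + y
  re₁ = solve-∀
  re₂ : ∀ a e x y → a + (e + x) + y ≡ x + y + e + a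
  re₂ = solve-∀
  split : K (r ∷ rs) s (suc d) ≈ A ⊕ E
  split = K-split r rs s d
  -- A label on the bottom level is either dispensable for `r` or exactly the one that completes it;
  -- only in the first case may it be raised.
  boundary : A ≈ X ⊕ Y
  boundary k = trans (lin-cong d (λ b a _ k → trans (cong (_* shift a (K rs (suc (s + b)) a) k) (reached-suc r (s + b)))
    (*-distribʳ-+ (shift a (K rs (suc (s + b)) a) k) (reached r (s + b)) (missed r (s + b)))) k)
    (lin-⊕ d (λ b a → reached r (s + b) · shift a (K rs (suc (s + b)) a))
        (λ b a → missed r (s + b) · shift a (K rs (suc (s + b)) a)) k)
  term : ∀ b a → shift (suc a) (K rs (s + b) (suc a)) ⊕ shift (suc a) (Neg rs (s + b) a) ≈
         (q· shift (suc a) (K rs (s + b) (suc a))) ⊕ shift (suc a) (K rs (suc (s + b)) a)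
  term b a k = begin
    shift (suc a) (K rs (s + b) (suc a)) k + shift (suc a) (Neg rs (s + b) a) k  ≡⟨ shift-⊕ (suc a) _ _ k ⟨
    shift (suc a) (K rs (s + b) (suc a) ⊕ Neg rs (s + b) a) k                    ≡⟨ shift-cong (suc a)
        (telescope rs (s + b) a) k ⟩
    shift (suc a) ((q· K rs (s + b) (suc a)) ⊕ K rs (suc (s + b)) a) k           ≡⟨ shift-⊕ (suc a) _ _ k ⟩
    shift (suc a) (q· K rs (s + b) (suc a)) k + shift (suc a) (K rs (suc (s + b)) a) k
      ≡⟨ cong (λ P → P k + shift (suc a) (K rs (suc (s + b)) a) k) (shift-q (suc a) _) ⟩
    (q· shift (suc a) (K rs (s + b) (suc a))) k + shift (suc a) (K rs (suc (s + b)) a) k ∎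
  c : ℕ → ℕ → ℕ
  c b _ = reached r (s + b)
  U V W : ℕ → ℕ → Poly
  U b a = shift (suc a) (K rs (s + b) (suc a))
  V b a = shift a (Neg rs (s + b) a)
  W b a = shift a (K rs (suc (s + b)) a)
  inner : E ⊕ (q· N) ≈ (q· E) ⊕ (q· X)
  inner k = begin
    E k + (q· N) k                                                     ≡⟨ cong (E k +_) (distrib 1 d c V k) ⟩
    E k + lin d (λ b a → c b a · (q· V b a)) k                         ≡⟨ weighted-⊕ d c U (λ b a → q· V b a) k ⟨
    lin d (λ b a → c b a · (U b a ⊕ (q· V b a))) k                     ≡⟨ lin-cong d
        (λ b a _ k → cong (c b a *_) (term b a k)) k ⟩
    lin d (λ b a → c b a · ((q· U b a) ⊕ (q· W b a))) k                ≡⟨ weighted-⊕ d c (λ b a → q· U b a)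
        (λ b a → q· W b a) k ⟩
    lin d (λ b a → c b a · (q· U b a)) k + lin d (λ b a → c b a · (q· W b a)) k
      ≡⟨ cong₂ _+_ (distrib 1 d c U k) (distrib 1 d c W k) ⟨
    (q· E) k + (q· X) k                                                ∎

-- Comparison with the placements that just miss a guard.

Feasible-mono : ∀ {m n rs} → m ≤ n → Feasible rs m → Feasible rs n
Feasible-mono m≤n []       = []
Feasible-mono m≤n (l ∷ ls) = ≤-trans l m≤n ∷ Feasible-mono m≤n ls

-- The right side is the part of `Neg` due to the guard `r`. Every summand on the left is compared
-- with every summand on the right: `r ≤ s + x` and `r ≡ suc (s + y)` force `y < x`, and the
-- summands interlace as `A (suc z) b ≼ M z b ≼ A z (suc b)`.
met-≼-missed : ∀ xs r ys s d → LC-upto d → K (xs ++ r ∷ ys) s (suc d) ≼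
  shift (suc (length xs)) (lin d (λ y a → missed r (s + y) · shift (suc (length xs) * a)
      (K xs s y ⊛ K ys (suc (s + y)) a)))
met-≼-missed xs r ys s d h = ≼-resp (≈-sym (cut xs r ys s (suc d))) (≈-sym rhs)
  (lin-≼ (suc d) λ x a e → ≼-lin d λ y b e′ → term x a y b e e′ (reached? r (s + x)) (missed? r (s + y)))
  where
  t = suc (length xs)
  A M : ℕ → ℕ → Poly
  A x a = shift (t * a) (K xs s x ⊛ K ys (s + x) a)
  M y b = shift (t * suc b) (K xs s y ⊛ K ys (suc (s + y)) b)
  rhs : shift t (lin d (λ y a → missed r (s + y) · shift (t * a) (K xs s y ⊛ K ys (suc (s + y)) a))) ≈
        lin d (λ y a → missed r (s + y) · M y a)
  rhs = ≈-trans (distrib t d (λ y _ → missed r (s + y)) (λ y a → shift (t * a) (K xs s y ⊛ K ys (suc (s + y)) a)))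
    (lin-cong d λ y a _ k → cong (missed r (s + y) *_)
        (shift-shift {t} {t * a} (K xs s y ⊛ K ys (suc (s + y)) a) (sym (*-suc t a)) k))
  z≤ : ∀ {z b} → z + suc b ≡ suc d → z ≤ d
  z≤ {z} {b} e = ≤-trans (m≤m+n z b) (≤-reflexive (suc-injective (trans (sym (+-suc z b)) e)))
  b≤ : ∀ {z b} → z + suc b ≡ suc d → b ≤ d
  b≤ {z} {b} e = ≤-trans (m≤n+m b z) (≤-reflexive (suc-injective (trans (sym (+-suc z b)) e)))
  -- The lower group gives up one label, which is then held one level above that group's top:
  -- `K-suc-≼-shift` and one more `q`.
  A≼M : ∀ z b → z + suc b ≡ suc d → A (suc z) b ≼ M z b
  A≼M z b e = ≼-resp {A (suc z) b} (λ _ → refl) shifts (shift-≼ (t * b)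
    (subst (λ u → K xs s (suc z) ⊛ K ys u b ≼ shift t (K xs s z) ⊛ K ys (suc (s + z)) b) (sym (+-suc s z))
      (⊛-≼ˡ (≼-qʳ (K-suc-≼-shift (reverseView xs) s z (LC-upto-≤ (z≤ e) h)) (LC-shift (length xs) (h (z≤ e) xs s)))
            (h (b≤ e) ys (suc (s + z))))))
    where
    shifts : shift (t * b) (shift t (K xs s z) ⊛ K ys (suc (s + z)) b) ≈ M z b
    shifts k = trans (shift-cong (t * b) (shift-⊛ t (K xs s z) (K ys (suc (s + z)) b)) k)
      (shift-shift {t * b} {t} _ (trans (+-comm (t * b) t) (sym (*-suc t b))) k)
  -- For the upper group the same label is held on its bottom level, so releasing it is `K-≼-suc`.
  M≼A : ∀ z b → z + suc b ≡ suc d → M z b ≼ A z (suc b)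
  M≼A z b e = shift-≼ (t * suc b) (⊛-≼ʳ (K-≼-suc ys (s + z) b (LC-upto-≤ (b≤ e) h)) (h (z≤ e) xs s))
  term : ∀ x a y b → x + a ≡ suc d → y + b ≡ d →
         (r ≤ s + x × reached r (s + x) ≡ 1) ⊎ (s + x < r × reached r (s + x) ≡ 0) → r ≡ suc (s + y) ⊎ missed r
             (s + y) ≡ 0 →
         reached r (s + x) · A x a ≼ missed r (s + y) · M y b
  term x a y b e e′ (inj₂ (_ , z)) _        = zero-≼ λ k → cong (_* A x a k) z
  term x a y b e e′ (inj₁ _)       (inj₂ z) = ≼-zero λ k → cong (_* M y b k) z
  term x a y b e e′ (inj₁ (r≤ , _)) (inj₁ r≡) = ·-≼ (reached r (s + x)) (≼-· (missed r (s + y)) main)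
    where
    y<x : y < x
    y<x = +-cancelˡ-< s y x (subst (_≤ s + x) r≡ r≤)
    y+1+b : y + suc b ≡ suc d
    y+1+b = trans (+-suc y b) (cong suc e′)
    main : A x a ≼ M y b
    main with all? (_≤? s + y) xs | all? (_≤? s + suc d) ys
    ... | no ¬f | _ = ≼-zero (shift-null (t * suc b) (⊛-nullˡ (K ys (suc (s + y)) b) (K-null xs s y ¬f)))
    ... | yes _ | no ¬f = ≼-zero (shift-null (t * suc b) (⊛-nullʳ (K xs s y)
            (K-null ys (suc (s + y)) b (¬f ∘ subst (Feasible ys)
                (trans (cong suc (+-assoc s y b)) (trans (sym (+-suc s (y + b))) (cong (λ n → s + suc n) e′)))))))
    ... | yes f | yes f′ = ≼-trans
        (descend-< A (λ z c y<z e₁ → ≼-trans (A≼M z c e₁) (posM z c y<z e₁) (M≼A z c e₁)) posA (cong suc e′) e y<x)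
        (posA (suc y) b ≤-refl (cong suc e′)) (A≼M y b y+1+b)
      where
      posA : ∀ z c → suc y ≤ z → z + c ≡ suc d → Pos (A z c)
      posA z c y<z e₁ = shift-Pos (t * c)
          (⊛-Pos {K xs s z} {K ys (s + z) c} (K-pos xs s z (Feasible-mono (+-monoʳ-≤ s (<⇒≤ y<z)) f))
        (K-pos ys (s + z) c (subst (Feasible ys) (sym (trans (+-assoc s z c) (cong (s +_) e₁))) f′)))
      posM : ∀ z c → suc y ≤ z → z + suc c ≡ suc d → Pos (M z c)
      posM z c y<z e₁ = shift-Pos (t * suc c)
          (⊛-Pos {K xs s z} {K ys (suc (s + z)) c} (K-pos xs s z (Feasible-mono (+-monoʳ-≤ s (<⇒≤ y<z)) f))
        (K-pos ys (suc (s + z)) c (subst (Feasible ys)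
            (sym (trans (sym (+-suc (s + z) c)) (trans (+-assoc s z (suc c)) (cong (s +_) e₁)))) f′)))

-- The recursion of `Neg` accumulates guards met by other labels, here `xs ++ [ r ]`, so the
-- induction must allow such a prefix. The equation for `t` absorbs that an appended list has length
-- `suc (length xs)` only propositionally.
K-≼-prefixed-Neg : ∀ xs r ys s d t → t ≡ suc (length xs) → LC-upto d → K (xs ++ r ∷ ys) s (suc d) ≼
  shift t (lin d (λ x a → reached r (s + x) · shift (t * a) (K xs s x ⊛ Neg ys (s + x) a)))
-- The label has left the top level: the bound for a label on the top level, times one further `q`.
K-≼-prefixed-Neg xs r [] s d t refl h = ≼-resp {K (xs ++ [ r ]) s (suc d)} (λ _ → refl) (≈-sym rhs)
  (≼-qʳ (subst (λ n → K (xs ++ [ r ]) s (suc d) ≼ shift n (K (xs ++ [ r ]) s d)) (length-snoc xs r)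
          (K-suc-≼-shift (reverseView (xs ++ [ r ])) s d h))
        (LC-shift t (h ≤-refl (xs ++ [ r ]) s)))
  where
  rhs : shift t (lin d (λ x a → reached r (s + x) · shift (t * a) (K xs s x ⊛ (q· 𝟙)))) ≈ q· shift t
      (K (xs ++ [ r ]) s d)
  rhs k = begin
    shift t (lin d (λ x a → reached r (s + x) · shift (t * a) (K xs s x ⊛ (q· 𝟙)))) k
      ≡⟨ shift-cong t (lin-cong d λ x a _ k → cong (reached r (s + x) *_)
           (trans (shift-cong (t * a) (≈-trans (⊛-shift 1 (K xs s x) 𝟙) (q-cong (⊛-𝟙 (K xs s x)))) k)
                  (cong (λ P → P k) (shift-q (t * a) (K xs s x))))) k ⟩
    shift t (lin d (λ x a → reached r (s + x) · (q· shift (t * a) (K xs s x)))) k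
      ≡⟨ shift-cong t (distrib 1 d (λ x _ → reached r (s + x)) (λ x a → shift (t * a) (K xs s x))) k ⟨
    shift t (q· lin d (λ x a → reached r (s + x) · shift (t * a) (K xs s x))) k
      ≡⟨ cong (λ P → P k) (shift-q t _) ⟩
    (q· shift t (lin d (λ x a → reached r (s + x) · shift (t * a) (K xs s x)))) k
      ≡⟨ q-cong (shift-cong t (peel xs r s d)) k ⟨
    (q· shift t (K (xs ++ [ r ]) s d)) k ∎
    where open ≡-Reasoning
-- In the first summand of `Neg` the guard `r′` joins the prefix; the second is `met-≼-missed`.
-- `advance` brings both into shape.
K-≼-prefixed-Neg xs r (r′ ∷ ys) s d t refl h = ≼-resp {K (xs ++ r ∷ r′ ∷ ys) s (suc d)} (λ _ → refl) (≈-sym rhs)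
  (≼-⊕ (subst (λ zs → K zs s (suc d) ≼ shift (suc t) G) (++-assoc xs [ r ] (r′ ∷ ys))
          (K-≼-prefixed-Neg (xs ++ [ r ]) r′ ys s d (suc t) (cong suc (sym (length-snoc xs r))) h))
        (subst₂ (λ zs n → K zs s (suc d) ≼ shift n
            (lin d (λ y a → missed r′ (s + y) · shift (n * a) (K (xs ++ [ r ]) s y ⊛ K ys (suc (s + y)) a))))
          (++-assoc xs [ r ] (r′ ∷ ys)) (cong suc (length-snoc xs r)) (met-≼-missed (xs ++ [ r ]) r′ ys s d h)))
  where
  G H : Poly
  G = lin d (λ y a → reached r′ (s + y) · shift (suc t * a) (K (xs ++ [ r ]) s y ⊛ Neg ys (s + y) a))
  H = lin d (λ y a → missed r′ (s + y) · shift (suc t * a) (K (xs ++ [ r ]) s y ⊛ K ys (suc (s + y)) a))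
  S₁ S₂ : ℕ → ℕ → Poly
  S₁ x a = K xs s x ⊛ lin a (λ b a′ → reached r′ (s + x + b) · shift a′ (Neg ys (s + x + b) a′))
  S₂ x a = K xs s x ⊛ lin a (λ b a′ → missed r′ (s + x + b) · shift a′ (K ys (suc (s + x + b)) a′))
  c : ℕ → ℕ → ℕ
  c x _ = reached r (s + x)
  inner : ∀ x a → shift (t * a) (K xs s x ⊛ Neg (r′ ∷ ys) (s + x) a) ≈ (q· shift (t * a) (S₁ x a)) ⊕
      (q· shift (t * a) (S₂ x a))
  inner x a k = begin
    shift (t * a) (K xs s x ⊛ Neg (r′ ∷ ys) (s + x) a) k
      ≡⟨ shift-cong (t * a) (λ k → trans (⊛-⊕ (K xs s x) _ _ k)
           (cong₂ _+_ (⊛-shift 1 (K xs s x) _ k) (⊛-shift 1 (K xs s x) _ k))) k ⟩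
    shift (t * a) ((q· S₁ x a) ⊕ (q· S₂ x a)) k             ≡⟨ shift-⊕ (t * a) _ _ k ⟩
    shift (t * a) (q· S₁ x a) k + shift (t * a) (q· S₂ x a) k
      ≡⟨ cong₂ (λ P Q → P k + Q k) (shift-q (t * a) (S₁ x a)) (shift-q (t * a) (S₂ x a)) ⟩
    (q· shift (t * a) (S₁ x a)) k + (q· shift (t * a) (S₂ x a)) k ∎
    where open ≡-Reasoning
  rhs : shift t (lin d (λ x a → reached r (s + x) · shift (t * a) (K xs s x ⊛ Neg (r′ ∷ ys) (s + x) a))) ≈
        shift (suc t) G ⊕ shift (suc t) H
  rhs k = begin
    shift t (lin d (λ x a → c x a · shift (t * a) (K xs s x ⊛ Neg (r′ ∷ ys) (s + x) a))) k
      ≡⟨ shift-cong t (λ k → trans (lin-cong d (λ x a _ k → cong (c x a *_) (inner x a k)) k)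
           (weighted-⊕ d c (λ x a → q· shift (t * a) (S₁ x a)) (λ x a → q· shift (t * a) (S₂ x a)) k)) k ⟩
    shift t (lin d (λ x a → c x a · (q· shift (t * a) (S₁ x a))) ⊕ lin d
        (λ x a → c x a · (q· shift (t * a) (S₂ x a)))) k
      ≡⟨ shift-⊕ t _ _ k ⟩
    shift t (lin d (λ x a → c x a · (q· shift (t * a) (S₁ x a)))) k + shift t
        (lin d (λ x a → c x a · (q· shift (t * a) (S₂ x a)))) k
      ≡⟨ cong₂ _+_ (move S₁ G (advance xs r s d (reached r′) (Neg ys)) k)
                   (move S₂ H (advance xs r s d (missed r′) (λ u → K ys (suc u))) k) ⟩
    shift (suc t) G k + shift (suc t) H k ∎
    where
    open ≡-Reasoning
    move : ∀ (S : ℕ → ℕ → Poly) T → lin d (λ x a → c x a · shift (t * a) (S x a)) ≈ T →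
           shift t (lin d (λ x a → c x a · (q· shift (t * a) (S x a)))) ≈ shift (suc t) T
    move S T e k = trans (shift-cong t (≈-sym (distrib 1 d c (λ x a → shift (t * a) (S x a)))) k)
      (trans (cong (λ P → P k) (shift-q t _)) (shift-cong (suc t) e k))

K-≼-Neg : ∀ rs s d → LC-upto d → K rs s (suc d) ≼ Neg rs s d
K-≼-Neg [] s d h = lr go
  where
  go : ∀ {i j} → i ≤ j → 𝟙 j * (q· 𝟙) i ≤ 𝟙 i * (q· 𝟙) j
  go {zero}  {j}     _ = ≤-trans (≤-reflexive (*-zeroʳ (𝟙 j))) z≤n
  go {suc i} {suc j} _ = z≤n
K-≼-Neg (r ∷ ys) s d h = ≼-⊕
  (≼-resp {K (r ∷ ys) s (suc d)} (λ _ → refl)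
      (q-cong (lin-cong d λ x a _ k → cong (reached r (s + x) *_) (unit a (Neg ys (s + x) a) k)))
    (K-≼-prefixed-Neg [] r ys s d 1 refl h))
  (≼-resp {K (r ∷ ys) s (suc d)} (λ _ → refl)
      (q-cong (lin-cong d λ x a _ k → cong (missed r (s + x) *_) (unit a (K ys (suc (s + x)) a) k)))
    (met-≼-missed [] r ys s d h))
  where
  unit : ∀ a P → shift (1 * a) (𝟙 ⊛ P) ≈ shift a P
  unit a P k = trans (cong (λ n → shift n (𝟙 ⊛ P) k) (*-identityˡ a)) (shift-cong a (𝟙-⊛ P) k)

-- Log-concavity of the placement polynomials.

-- Substituting `f k = f (suc k) + N (suc k) - A (suc k)` for `k = i, j` turns
-- `f (suc i) * f j - f i * f (suc j)` into a minor of `f` and `N` plus a minor of `A` and `f`. The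
-- terms added on both sides avoid subtraction.
LC-from-telescope : ∀ {f A N} → f ⊕ N ≈ (q· f) ⊕ A → A ≼ f → f ≼ N → LC f
LC-from-telescope {f} {A} {N} tel (lr A≼f) (lr f≼N) = lc λ {i} {j} i≤j → +-cancelʳ-≤ _ _ _ (begin
  f i * f (suc j) + (A (suc i) * f (suc j) + f (suc i) * A (suc j))
    ≡⟨ re₁ (f i) (f (suc j)) (A (suc i)) (f (suc i) * A (suc j)) ⟩
  (f i + A (suc i)) * f (suc j) + f (suc i) * A (suc j)
    ≡⟨ cong (λ x → x * f (suc j) + f (suc i) * A (suc j)) (tel (suc i)) ⟨
  (f (suc i) + N (suc i)) * f (suc j) + f (suc i) * A (suc j)
    ≡⟨ re₂ (f (suc i)) (N (suc i)) (f (suc j)) (A (suc j)) ⟩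
  f (suc i) * f (suc j) + f (suc j) * N (suc i) + A (suc j) * f (suc i)
    ≤⟨ +-mono-≤ (+-monoʳ-≤ (f (suc i) * f (suc j)) (f≼N (s≤s i≤j))) (A≼f (s≤s i≤j)) ⟩
  f (suc i) * f (suc j) + f (suc i) * N (suc j) + A (suc i) * f (suc j)
    ≡⟨ cong (_+ A (suc i) * f (suc j)) (*-distribˡ-+ (f (suc i)) (f (suc j)) (N (suc j))) ⟨
  f (suc i) * (f (suc j) + N (suc j)) + A (suc i) * f (suc j)
    ≡⟨ cong (λ x → f (suc i) * x + A (suc i) * f (suc j)) (tel (suc j)) ⟩
  f (suc i) * (f j + A (suc j)) + A (suc i) * f (suc j)
    ≡⟨ re₃ (f (suc i)) (f j) (A (suc j)) (A (suc i) * f (suc j)) ⟩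
  f (suc i) * f j + (A (suc i) * f (suc j) + f (suc i) * A (suc j)) ∎)
  where
  open ≤-Reasoning
  re₁ : ∀ a b c e → a * b + (c * b + e) ≡ (a + c) * b + e
  re₁ = solve-∀
  re₂ : ∀ a b c e → (a + b) * c + a * e ≡ a * c + c * b + e * a
  re₂ = solve-∀
  re₃ : ∀ a b c e → a * (b + c) + e ≡ a * b + (e + a * c)
  re₃ = solve-∀

K-LC : ∀ d → LC-upto d
K-LC zero z≤n rs s = lc λ {i} {j} _ → ≤-trans
    (≤-reflexive (trans (cong (K rs s 0 i *_) (K-zero rs s j)) (*-zeroʳ (K rs s 0 i)))) z≤n
K-LC (suc d) {e} e≤ rs s with m≤n⇒m<n∨m≡n e≤
... | inj₁ (s≤s e≤d) = K-LC d e≤d rs s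
... | inj₂ refl      = LC-from-telescope (telescope rs s d) (K-≼-suc rs s d (K-LC d)) (K-≼-Neg rs s d (K-LC d))

-- Counting vectors by the level of their first entry.

Σ< : ℕ → (ℕ → ℕ) → ℕ
Σ< zero    f = 0
Σ< (suc n) f = f 0 + Σ< n (f ∘ suc)

Σ<-cong : ∀ n {f g : ℕ → ℕ} → (∀ t → f t ≡ g t) → Σ< n f ≡ Σ< n g
Σ<-cong zero    h = refl
Σ<-cong (suc n) h = cong₂ _+_ (h 0) (Σ<-cong n (h ∘ suc))

Σ<-zero : ∀ n {f : ℕ → ℕ} → (∀ t → f t ≡ 0) → Σ< n f ≡ 0
Σ<-zero zero    h = refl
Σ<-zero (suc n) h = cong₂ _+_ (h 0) (Σ<-zero n (h ∘ suc))

Σ<-*ˡ : ∀ n c f → c * Σ< n f ≡ Σ< n (λ t → c * f t)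
Σ<-*ˡ zero    c f = *-zeroʳ c
Σ<-*ˡ (suc n) c f = trans (*-distribˡ-+ c _ _) (cong (c * f 0 +_) (Σ<-*ˡ n c (f ∘ suc)))

∑-Σ< : ∀ d n (f : ℕ → ℕ → ℕ → ℕ) → ∑ d (λ i j → Σ< n (f i j)) ≡ Σ< n (λ t → ∑ d (λ i j → f i j t))
∑-Σ< d zero    f = ∑-zero d
∑-Σ< d (suc n) f = trans (∑-+ d _ _) (cong (∑ d (λ i j → f i j 0) +_) (∑-Σ< d n (λ i j t → f i j (suc t))))

shift-Σ< : ∀ m n (P : ℕ → Poly) → shift m (λ k → Σ< n (λ t → P t k)) ≈ (λ k → Σ< n (λ t → shift m (P t) k))
shift-Σ< zero    n P k       = refl
shift-Σ< (suc m) n P zero    = sym (Σ<-zero n λ _ → refl)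
shift-Σ< (suc m) n P (suc k) = shift-Σ< m n P k

-- Reconciles two cutoffs of different origin: the entries offered by the box and the levels that
-- exist.
Σ<-match : ∀ m n {f g : ℕ → ℕ} → (∀ {t} → t < m → t < n → f t ≡ g t) →
           (∀ {t} → n ≤ t → f t ≡ 0) → (∀ {t} → m ≤ t → g t ≡ 0) → Σ< m f ≡ Σ< n g
Σ<-match zero    n       e f0 g0 = sym (Σ<-zero n λ t → g0 {t} z≤n)
Σ<-match (suc m) zero    e f0 g0 = Σ<-zero (suc m) λ t → f0 {t} z≤n
Σ<-match (suc m) (suc n) e f0 g0 = cong₂ _+_ (e (s≤s z≤n) (s≤s z≤n))
  (Σ<-match m n (λ l l′ → e (s≤s l) (s≤s l′)) (f0 ∘ s≤s) (g0 ∘ s≤s))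

-- The guards seen by the remaining labels once one label has been put on level t.
relax : ℕ → List ℕ → List ℕ
relax zero    rs       = map pred rs
relax (suc t) []       = []
relax (suc t) (r ∷ rs) = r ∷ relax t rs

length-relax : ∀ t rs → length (relax t rs) ≡ length rs
length-relax zero    rs       = length-map pred rs
length-relax (suc t) []       = refl
length-relax (suc t) (r ∷ rs) = cong suc (length-relax t rs)

K-pred : ∀ rs s d → K rs (suc s) d ≈ K (map pred rs) s d
K-pred []       s d k = refl
K-pred (r ∷ rs) s d = lin-cong d λ b a _ k → cong₂ _*_ (guard r (s + b)) (shift-cong a (K-pred rs (s + b) a) k)
  where
  guard : ∀ r u → reached r (suc u) ≡ reached (pred r) u
  guard zero    u = refl
  guard (suc r) u = refl

-- Conditions on the level `t` of one label, which adds `t` to the total and relaxes the guards from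
-- level `t` on. This recursion matches reading a vector entry by entry.
K-label : ∀ rs s d k → K rs s (suc d) k ≡ Σ< (suc (length rs)) (λ t → shift t (K (relax t rs) s d) k)
K-label []       s d k = sym (+-identityʳ (𝟙 k))
K-label (r ∷ rs) s d k = begin
  K (r ∷ rs) s (suc d) k                                                   ≡⟨ K-split r rs s d k ⟩
  K (r ∷ rs) (suc s) d k + lin d (λ b a → c b · shift (suc a) (K rs (s + b) (suc a))) k
    ≡⟨ cong₂ _+_ (K-pred (r ∷ rs) s d k) higher ⟩
  K (map pred (r ∷ rs)) s d k + Σ< l (λ t → shift (suc t) (K (r ∷ relax t rs) s d) k) ∎
  where
  open ≡-Reasoning
  l = suc (length rs)
  c : ℕ → ℕ
  c b = reached r (s + b)
  Y : ℕ → ℕ → ℕ → Poly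
  Y b a t = K (relax t rs) (s + b) a
  term : ∀ b a → bin b a * (c b * shift (suc a) (K rs (s + b) (suc a)) k) ≡
                 Σ< l (λ t → bin b a * (c b * shift (suc t) (shift a (Y b a t)) k))
  term b a = begin
    bin b a * (c b * shift (suc a) (K rs (s + b) (suc a)) k)
      ≡⟨ cong (λ x → bin b a * (c b * x))
          (trans (shift-cong (suc a) (K-label rs (s + b) a) k) (shift-Σ< (suc a) l (λ t → shift t (Y b a t)) k)) ⟩
    bin b a * (c b * Σ< l (λ t → shift (suc a) (shift t (Y b a t)) k))
      ≡⟨ cong (bin b a *_) (Σ<-*ˡ l (c b) (λ t → shift (suc a) (shift t (Y b a t)) k)) ⟩
    bin b a * Σ< l (λ t → c b * shift (suc a) (shift t (Y b a t)) k)
      ≡⟨ Σ<-*ˡ l (bin b a) (λ t → c b * shift (suc a) (shift t (Y b a t)) k) ⟩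
    Σ< l (λ t → bin b a * (c b * shift (suc a) (shift t (Y b a t)) k))
      ≡⟨ Σ<-cong l (λ t → cong (λ P → bin b a * (c b * (q· P) k)) (trans (shift-+ a t (Y b a t))
           (trans (cong (λ n → shift n (Y b a t)) (+-comm a t)) (sym (shift-+ t a (Y b a t)))))) ⟩
    Σ< l (λ t → bin b a * (c b * shift (suc t) (shift a (Y b a t)) k)) ∎
  higher : lin d (λ b a → c b · shift (suc a) (K rs (s + b) (suc a))) k ≡ Σ< l
      (λ t → shift (suc t) (K (r ∷ relax t rs) s d) k)
  higher = begin
    ∑ d (λ b a → bin b a * (c b * shift (suc a) (K rs (s + b) (suc a)) k))
      ≡⟨ ∑-cong d (λ b a _ → term b a) ⟩
    ∑ d (λ b a → Σ< l (λ t → bin b a * (c b * shift (suc t) (shift a (Y b a t)) k)))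
      ≡⟨ ∑-Σ< d l (λ b a t → bin b a * (c b * shift (suc t) (shift a (Y b a t)) k)) ⟩
    Σ< l (λ t → ∑ d (λ b a → bin b a * (c b * shift (suc t) (shift a (Y b a t)) k)))
      ≡⟨ Σ<-cong l (λ t → distrib (suc t) d (λ b _ → c b) (λ b a → shift a (Y b a t)) k) ⟨
    Σ< l (λ t → shift (suc t) (K (r ∷ relax t rs) s d) k) ∎

Admissible : ∀ {n} → List ℕ → ℕ → Vec ℕ n → Set
Admissible rs s []ᵛ           = Feasible rs s
Admissible rs s (zero  ∷ᵛ v)  = ⊥
Admissible rs s (suc t ∷ᵛ v)  = t ≤ length rs × Admissible (relax t rs) s v

length-filter-map : ∀ {A B : Set} {P : B → Set} (P? : Decidable P) (f : A → B) xs →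
                    length (filter P? (map f xs)) ≡ length (filter (P? ∘ f) xs)
length-filter-map P? f []       = refl
length-filter-map P? f (x ∷ xs) with P? (f x)
... | yes _ = cong suc (length-filter-map P? f xs)
... | no  _ = length-filter-map P? f xs

length-filter-concatMap : ∀ {A : Set} {P : A → Set} (P? : Decidable P) (f : ℕ → List A) m g →
  length (filter P? (concatMap f (map suc (applyUpTo g m)))) ≡ Σ< m (λ t → length (filter P? (f (suc (g t)))))
length-filter-concatMap P? f zero    g = refl
length-filter-concatMap P? f (suc m) g = begin
  length (filter P? (f (suc (g 0)) ++ rest))                     ≡⟨ cong length (filter-++ P? (f (suc (g 0))) rest) ⟩
  length (filter P? (f (suc (g 0))) ++ filter P? rest)           ≡⟨ length-++ (filter P? (f (suc (g 0)))) ⟩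
  length (filter P? (f (suc (g 0)))) + length (filter P? rest)   ≡⟨ cong (length (filter P? (f (suc (g 0)))) +_)
      (length-filter-concatMap P? f m (g ∘ suc)) ⟩
  length (filter P? (f (suc (g 0)))) + Σ< m (λ t → length (filter P? (f (suc (g (suc t)))))) ∎
  where
  open ≡-Reasoning
  rest = concatMap f (map suc (applyUpTo (g ∘ suc) m))

length-filter-boxVecs : ∀ n m {P : Vec ℕ (suc n) → Set} (P? : Decidable P) →
  length (filter P? (boxVecs (suc n) m)) ≡ Σ< m (λ t → length (filter (λ v → P? (suc t ∷ᵛ v)) (boxVecs n m)))
length-filter-boxVecs n m P? = trans (length-filter-concatMap P? (λ a → map (a ∷ᵛ_) (boxVecs n m)) m id)
  (Σ<-cong m λ t → length-filter-map P? (suc t ∷ᵛ_) (boxVecs n m))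

shift-at : ∀ n A {k} → n ≤ k → shift n A k ≡ A (k ∸ n)
shift-at zero    A _       = refl
shift-at (suc n) A (s≤s l) = shift-at n A l

shift-below : ∀ n A {k} → k < n → shift n A k ≡ 0
shift-below (suc n) A {zero}  _       = refl
shift-below (suc n) A {suc k} (s≤s l) = shift-below n A l

K-zero-one : ∀ rs s → Feasible rs s → K rs s 0 0 ≡ 1
K-zero-one []       s _        = refl
K-zero-one (r ∷ rs) s (l ∷ ls) rewrite +-identityʳ s with reached? r s
... | inj₁ (_ , e) rewrite e | K-zero-one rs s ls = refl
... | inj₂ (g , _) = contradiction l (<⇒≱ g)

-- `P` is any decidable form of the condition, since its restriction to tails `P (suc t ∷ᵛ v)` is
-- again of this kind, with a smaller `k`. The `shift n` is the offset between entries, which start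
-- at `1`, and levels, which start at `0`.
count-admissible : ∀ n m k rs s {P : Vec ℕ n → Set} (P? : Decidable P) → k ≤ m →
  (∀ v → P v → Admissible rs s v × vsum v ≡ k) → (∀ v → Admissible rs s v → vsum v ≡ k → P v) →
  length (filter P? (boxVecs n m)) ≡ shift n (K rs s n) k
count-admissible zero m k rs s P? k≤m to from with P? []ᵛ
... | yes p with to []ᵛ p
...   | f , refl = sym (K-zero-one rs s f)
count-admissible zero m zero    rs s P? k≤m to from | no ¬p =
  sym (K-null rs s 0 (λ f → ¬p (from []ᵛ (subst (Feasible rs) (+-identityʳ s) f) refl)) 0)
count-admissible zero m (suc k) rs s P? k≤m to from | no ¬p = sym (K-zero rs s k)
count-admissible (suc n) m k rs s {P} P? k≤m to from = begin
  length (filter P? (boxVecs (suc n) m))                  ≡⟨ length-filter-boxVecs n m P? ⟩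
  Σ< m (λ t → number t)                                   ≡⟨ Σ<-match m (suc (length rs)) agree too-high too-large ⟩
  Σ< (suc (length rs)) (λ t → shift (suc n) (shift t (K (relax t rs) s n)) k)
    ≡⟨ shift-Σ< (suc n) (suc (length rs)) (λ t → shift t (K (relax t rs) s n)) k ⟨
  shift (suc n) (λ k → Σ< (suc (length rs)) (λ t → shift t (K (relax t rs) s n) k)) k
    ≡⟨ shift-cong (suc n) (K-label rs s n) k ⟨
  shift (suc n) (K rs s (suc n)) k                        ∎
  where
  open ≡-Reasoning
  number : ℕ → ℕ
  number t = length (filter (λ v → P? (suc t ∷ᵛ v)) (boxVecs n m))
  none : ∀ t → (∀ v → ¬ P (suc t ∷ᵛ v)) → number t ≡ 0
  none t h = cong length (filter-none (λ v → P? (suc t ∷ᵛ v)) (universal h (boxVecs n m)))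
  reorder : ∀ t → shift (suc n) (shift t (K (relax t rs) s n)) k ≡ shift (suc t) (shift n (K (relax t rs) s n)) k
  reorder t = cong (λ P → (q· P) k)
      (trans (shift-+ n t _) (trans (cong (λ x → shift x (K (relax t rs) s n)) (+-comm n t)) (sym (shift-+ t n _))))
  sum-exceeds : ∀ t → k < suc t → ∀ v → ¬ P (suc t ∷ᵛ v)
  sum-exceeds t k<t v p = <⇒≱ k<t (subst (suc t ≤_) (proj₂ (to (suc t ∷ᵛ v) p)) (m≤m+n (suc t) (vsum v)))
  agree : ∀ {t} → t < m → t < suc (length rs) → number t ≡ shift (suc n) (shift t (K (relax t rs) s n)) k
  agree {t} _ (s≤s t≤) with suc t ≤? k
  ... | no  t≰k = trans (none t (sum-exceeds t (≰⇒> t≰k))) (sym (trans (reorder t) (shift-below (suc t) _ (≰⇒> t≰k))))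
  ... | yes t≤k = trans
    (count-admissible n m (k ∸ suc t) (relax t rs) s (λ v → P? (suc t ∷ᵛ v)) (≤-trans (m∸n≤m k (suc t)) k≤m)
      (λ v p → proj₂ (proj₁ (to (suc t ∷ᵛ v) p)) , sym
          (trans (cong (_∸ suc t) (sym (proj₂ (to (suc t ∷ᵛ v) p)))) (m+n∸m≡n (suc t) (vsum v))))
      (λ v adm e → from (suc t ∷ᵛ v) (t≤ , adm) (trans (cong (suc t +_) e) (m+[n∸m]≡n t≤k))))
    (sym (trans (reorder t) (shift-at (suc t) _ t≤k)))
  too-high : ∀ {t} → suc (length rs) ≤ t → number t ≡ 0
  too-high {t} l = none t λ v p → <⇒≱ l (proj₁ (proj₁ (to (suc t ∷ᵛ v) p)))
  -- The box omits the levels `t ≥ m`, but their entries `suc t` already exceed `k`.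
  too-large : ∀ {t} → m ≤ t → shift (suc n) (shift t (K (relax t rs) s n)) k ≡ 0
  too-large {t} m≤t = trans (reorder t) (shift-below (suc t) _ (s≤s (≤-trans k≤m m≤t)))

-- Parking functions as placements with guards `1, …, m`.

count≤ : ℕ → List ℕ → ℕ
count≤ j l = length (filter (_≤? j) l)

count≤-accept : ∀ {j x} l → x ≤ j → count≤ j (x ∷ l) ≡ suc (count≤ j l)
count≤-accept {j} l x≤j = cong length (filter-accept (_≤? j) x≤j)

count≤-reject : ∀ {j x} l → j < x → count≤ j (x ∷ l) ≡ count≤ j l
count≤-reject {j} l j<x = cong length (filter-reject (_≤? j) (<⇒≱ j<x))

Guards : ℕ → List ℕ → ℕ → List ℕ → Set
Guards i []       s l = ⊤
Guards i (r ∷ rs) s l = r ≤ s + count≤ i l × Guards (suc i) rs s l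

pred-≤ : ∀ {r n} → r ≤ suc n → pred r ≤ n
pred-≤ {zero}  _       = z≤n
pred-≤ {suc r} (s≤s l) = l

≤-pred⁻ : ∀ {r n} → pred r ≤ n → r ≤ suc n
≤-pred⁻ {zero}  _ = z≤n
≤-pred⁻ {suc r} l = s≤s l

guards-pred⁺ : ∀ i rs s x l → x ≤ i → Guards i (map pred rs) s l → Guards i rs s (x ∷ l)
guards-pred⁺ i []       s x l x≤i _       = tt
guards-pred⁺ i (r ∷ rs) s x l x≤i (g , gs) =
  subst (r ≤_) (sym (trans (cong (s +_) (count≤-accept l x≤i)) (+-suc s _))) (≤-pred⁻ g) ,
  guards-pred⁺ (suc i) rs s x l (m≤n⇒m≤1+n x≤i) gs

guards-pred⁻ : ∀ i rs s x l → x ≤ i → Guards i rs s (x ∷ l) → Guards i (map pred rs) s l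
guards-pred⁻ i []       s x l x≤i _       = tt
guards-pred⁻ i (r ∷ rs) s x l x≤i (g , gs) =
  pred-≤ (subst (r ≤_) (trans (cong (s +_) (count≤-accept l x≤i)) (+-suc s _)) g) ,
  guards-pred⁻ (suc i) rs s x l (m≤n⇒m≤1+n x≤i) gs

-- The new entry `i + t` lies above the first `t` thresholds and is counted at all later ones.
guards-relax⁺ : ∀ t i rs s l → Guards i (relax t rs) s l → Guards i rs s (i + t ∷ l)
guards-relax⁺ zero    i rs       s l gs = guards-pred⁺ i rs s (i + 0) l (≤-reflexive (+-identityʳ i)) gs
guards-relax⁺ (suc t) i []       s l gs = tt
guards-relax⁺ (suc t) i (r ∷ rs) s l (g , gs) =
  subst (λ c → r ≤ s + c) (sym (count≤-reject l (m<m+n i (s≤s z≤n)))) g ,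
  subst (λ x → Guards (suc i) rs s (x ∷ l)) (sym (+-suc i t)) (guards-relax⁺ t (suc i) rs s l gs)

guards-relax⁻ : ∀ t i rs s l → Guards i rs s (i + t ∷ l) → Guards i (relax t rs) s l
guards-relax⁻ zero    i rs       s l gs = guards-pred⁻ i rs s (i + 0) l (≤-reflexive (+-identityʳ i)) gs
guards-relax⁻ (suc t) i []       s l gs = tt
guards-relax⁻ (suc t) i (r ∷ rs) s l (g , gs) =
  subst (λ c → r ≤ s + c) (count≤-reject l (m<m+n i (s≤s z≤n))) g ,
  guards-relax⁻ t (suc i) rs s l (subst (λ x → Guards (suc i) rs s (x ∷ l)) (+-suc i t) gs)

admissible⁺ : ∀ {n} rs s (v : Vec ℕ n) → All (1 ≤_) (toList v) → All (_≤ suc (length rs)) (toList v) →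
              Guards 1 rs s (toList v) → Admissible rs s v
admissible⁺ rs s []ᵛ _ _ gs = feasible 1 rs gs
  where
  feasible : ∀ i rs → Guards i rs s [] → Feasible rs s
  feasible i []       _        = []
  feasible i (r ∷ rs) (g , gs) = subst (r ≤_) (+-identityʳ s) g ∷ feasible (suc i) rs gs
admissible⁺ rs s (suc t ∷ᵛ v) (_ ∷ ps) (s≤s t≤ ∷ us) gs = t≤ ,
  admissible⁺ (relax t rs) s v ps (subst (λ n → All (_≤ suc n) (toList v)) (sym (length-relax t rs)) us)
    (guards-relax⁻ t 1 rs s (toList v) gs)

admissible⁻ : ∀ {n} rs s (v : Vec ℕ n) → Admissible rs s v →
              All (1 ≤_) (toList v) × All (_≤ suc (length rs)) (toList v) × Guards 1 rs s (toList v)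
admissible⁻ rs s []ᵛ fs = [] , [] , guards 1 rs fs
  where
  guards : ∀ i rs → Feasible rs s → Guards i rs s []
  guards i []       _        = tt
  guards i (r ∷ rs) (l ∷ ls) = subst (r ≤_) (sym (+-identityʳ s)) l , guards (suc i) rs ls
admissible⁻ rs s (suc t ∷ᵛ v) (t≤ , adm) with admissible⁻ (relax t rs) s v adm
... | ps , us , gs = s≤s z≤n ∷ ps ,
  s≤s t≤ ∷ subst (λ n → All (_≤ suc n) (toList v)) (length-relax t rs) us ,
  guards-relax⁺ t 1 rs s (toList v) gs

-- For a sorted list, `b_j ≤ j` for all `j` means that at least `j` entries are at most `j`. The
-- summand `i` stands for the entries already stripped off.
boundedFrom⁻ : ∀ i bs → AllPairs _≤_ bs → BoundedFrom (suc i) bs →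
               ∀ j → i < j → j ≤ i + length bs → j ≤ i + count≤ j bs
boundedFrom⁻ i []       _        _         j i<j j≤ = j≤
boundedFrom⁻ i (b ∷ bs) (_ ∷ ap) (b≤ , bd) j i<j j≤ with m≤n⇒m<n∨m≡n i<j
... | inj₁ 1+i<j = subst (j ≤_) (sym count)
    (boundedFrom⁻ (suc i) bs ap bd j 1+i<j (subst (j ≤_) (+-suc i (length bs)) j≤))
  where
  count : i + count≤ j (b ∷ bs) ≡ suc i + count≤ j bs
  count = trans (cong (i +_) (count≤-accept bs (≤-trans b≤ i<j))) (+-suc i _)
... | inj₂ refl = subst (suc i ≤_) (sym (trans (cong (i +_) (count≤-accept bs b≤)) (+-suc i _))) (s≤s (m≤m+n i _))

boundedFrom⁺ : ∀ i bs → AllPairs _≤_ bs → (∀ j → i < j → j ≤ i + length bs → j ≤ i + count≤ j bs) →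
               BoundedFrom (suc i) bs
boundedFrom⁺ i []       _         h = tt
boundedFrom⁺ i (b ∷ bs) (b≤ ∷ ap) h with b ≤? suc i
... | yes b≤i = b≤i , boundedFrom⁺ (suc i) bs ap λ j i<j j≤ →
  subst (j ≤_) (trans (cong (i +_) (count≤-accept bs (≤-trans b≤i (<⇒≤ i<j)))) (+-suc i _))
    (h j (<⇒≤ i<j) (subst (j ≤_) (sym (+-suc i (length bs))) j≤))
-- By sortedness a head above `suc i` leaves no entry that is at most `suc i`, so the count stops at
-- `i`.
... | no b≰i = contradiction (h (suc i) ≤-refl (subst (suc i ≤_) (sym (+-suc i (length bs))) (s≤s (m≤m+n i _))))
    (<⇒≱ (s≤s (≤-reflexive (trans (cong (i +_) (cong length (filter-none (_≤? suc i) (b≰i ∷ later b≤))))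
        (+-identityʳ i)))))
  where
  later : ∀ {cs} → All (b ≤_) cs → All (λ c → ¬ c ≤ suc i) cs
  later []       = []
  later (l ∷ ls) = (λ c≤ → b≰i (≤-trans l c≤)) ∷ later ls

upFrom : ℕ → ℕ → List ℕ
upFrom i zero    = []
upFrom i (suc ℓ) = i ∷ upFrom (suc i) ℓ

length-upFrom : ∀ i ℓ → length (upFrom i ℓ) ≡ ℓ
length-upFrom i zero    = refl
length-upFrom i (suc ℓ) = cong suc (length-upFrom (suc i) ℓ)

guards-upFrom⁺ : ∀ i ℓ l → (∀ j → i ≤ j → j < i + ℓ → j ≤ count≤ j l) → Guards i (upFrom i ℓ) 0 l
guards-upFrom⁺ i zero    l h = tt
guards-upFrom⁺ i (suc ℓ) l h = h i ≤-refl (m<m+n i (s≤s z≤n)) ,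
  guards-upFrom⁺ (suc i) ℓ l λ j i<j j< → h j (<⇒≤ i<j) (subst (j <_) (sym (+-suc i ℓ)) j<)

guards-upFrom⁻ : ∀ i ℓ l → Guards i (upFrom i ℓ) 0 l → ∀ j → i ≤ j → j < i + ℓ → j ≤ count≤ j l
guards-upFrom⁻ i zero    l _        j i≤j j< = contradiction (subst (j <_) (+-identityʳ i) j<) (≤⇒≯ i≤j)
guards-upFrom⁻ i (suc ℓ) l (g , gs) j i≤j j< with m≤n⇒m<n∨m≡n i≤j
... | inj₁ i<j  = guards-upFrom⁻ (suc i) ℓ l gs j i<j (subst (j <_) (+-suc i ℓ) j<)
... | inj₂ refl = g

count≤-sort : ∀ j l → count≤ j (sort l) ≡ count≤ j l
count≤-sort j l = ↭-length (filter-↭ (_≤? j) (sort-↭ l))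

-- The `suc m` levels carry the `m` guards `1, …, m`; the remaining count, that all `suc m` entries
-- are at most `suc m`, says that no entry lies above the top level.
parking⇒admissible : ∀ m (v : Vec ℕ (suc m)) → IsParkingFunction v → Admissible (upFrom 1 m) 0 v
parking⇒admissible m v (ps , bd) = admissible⁺ (upFrom 1 m) 0 v ps
  (subst (λ n → All (_≤ suc n) l) (sym (length-upFrom 1 m)) (subst (All (_≤ suc m)) full (all-filter (_≤? suc m) l)))
  (guards-upFrom⁺ 1 m l λ j 1≤j j< → enough j 1≤j (<⇒≤ j<))
  where
  l = toList v
  enough : ∀ j → 1 ≤ j → j ≤ suc m → j ≤ count≤ j l
  enough j 1≤j j≤ = subst (j ≤_) (count≤-sort j l)
    (boundedFrom⁻ 0 (sort l) (Linked⇒AllPairs ≤-trans (sort-↗ l)) bd j 1≤j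
      (subst (j ≤_) (sym (trans (↭-length (sort-↭ l)) (length-toList v))) j≤))
  full : filter (_≤? suc m) l ≡ l
  full = filter-complete (_≤? suc m) (≤-antisym (length-filter (_≤? suc m) l)
    (subst (_≤ count≤ (suc m) l) (sym (length-toList v)) (enough (suc m) (s≤s z≤n) ≤-refl)))

admissible⇒parking : ∀ m (v : Vec ℕ (suc m)) → Admissible (upFrom 1 m) 0 v → IsParkingFunction v
admissible⇒parking m v adm with admissible⁻ (upFrom 1 m) 0 v adm
... | ps , us , gs = ps , boundedFrom⁺ 0 (sort l) (Linked⇒AllPairs ≤-trans (sort-↗ l))
    λ j 1≤j j≤ → subst (j ≤_) (sym (count≤-sort j l))
        (enough j 1≤j (subst (j ≤_) (trans (↭-length (sort-↭ l)) (length-toList v)) j≤))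
  where
  l = toList v
  enough : ∀ j → 1 ≤ j → j ≤ suc m → j ≤ count≤ j l
  enough j 1≤j j≤ with m≤n⇒m<n∨m≡n j≤
  ... | inj₁ j<   = guards-upFrom⁻ 1 m l gs j 1≤j j<
  ... | inj₂ refl = ≤-reflexive (sym
      (trans (cong length (filter-all (_≤? suc m) (subst (λ n → All (_≤ suc n) l) (length-upFrom 1 m) us)))
      (length-toList v)))

coeff-K : ∀ m → coeff (suc m) ≈ shift (suc m) (K (upFrom 1 m) 0 (suc m))
coeff-K m k = count-admissible (suc m) k k (upFrom 1 m) 0 (λ v → isParkingFunction? v ×-dec (vsum v ≟ k)) ≤-refl
  (λ v (p , e) → parking⇒admissible m v p , e) (λ v adm e → admissible⇒parking m v adm , e)

theorem3p1 : ∀ (n : ℕ) → 1 ≤ n → LogConcave (coeff n) (degree n)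
theorem3p1 (suc m) _ (suc i) _ _ =
  LC.concave (LC-resp (≈-sym (coeff-K m)) (LC-shift (suc m) (K-LC (suc m) ≤-refl (upFrom 1 m) 0))) (n≤1+n i)
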